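{- Let $q>3$ be a prime power. The ideal $$\mathcal{J}_q+\langle x_{ij}-x_{ji}\colon 0\le i<j\le q-2\rangle\subset\mathbb{F}_q[\overline{X}_q]$$ is zero-dimensional and radical, and its algebraic set is identified with $\mathcal{SLP}_q$, via the bijection $(s_{ij})_{0\le i,j\le q-2}\mapsto\sum_{i,j=0}^{q-2}s_{ij}x^iy^j$. If $\mathcal{J}_q$ is replaced by $\mathcal{J}_{q,d}$ (for a nonnegative integer $d$), then the algebraic set of the resulting zero-dimensional radical ideal is identified in the same way with $\mathcal{SLP}_{q,d}$.
   Context: $\mathbb{F}_q$ is the finite field with $q$ elements. $\mathcal{LP}_q$ is the set of local permutation polynomials: polynomials $f\in\mathbb{F}_q[x,y]$ of degree less than $q$ in each variable such that, for every $a\in\mathbb{F}_q$, both $f(x,a)$ and $f(a,x)$ act as permutations of $\mathbb{F}_q$; $\mathcal{LP}_{q,d}$ is the subset of those of total degree $d$. $\mathcal{SLP}_q$ and $\mathcal{SLP}_{q,d}$ are the subsets of symmetric polynomials ($f(x,y)=f(y,x)$) in $\mathcal{LP}_q$ and $\mathcal{LP}_{q,d}$, respectively. $\overline{X}_q:=\{x_{ij}\colon 0\le i,j\le q-2\}$ is a set of variables (all indices below range over $\{0,\ldots,q-2\}$; an empty product is $1$). Put $F(x):=x^{q-1}-1$ and, for $a,b,c\in\mathbb{F}_q$ with $a\ne b$ (with $0^0=1$), $G^{\mathrm{row}}_{a,b,c}:=F(\sum_{i,j=0}^{q-2}(a^i-b^i)c^jx_{ji})$, $G^{\mathrm{col}}_{a,b,c}:=F(\sum_{i,j=0}^{q-2}(a^i-b^i)c^jx_{ij})$.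 Then $$\mathcal{J}_q:=\langle G^{\mathrm{row}}_{a,b,c},\,G^{\mathrm{col}}_{a,b,c}\colon a,b,c\in\mathbb{F}_q,\ a\neq b\rangle+\langle x_{ij}^q-x_{ij}\colon 0\le i,j\le q-2\rangle,$$ $$\mathcal{J}_{q,d}:=\mathcal{J}_q+\langle x_{ij}\colon i+j>d\rangle+\Big\langle\prod_{i+j=d}(x_{ij}^{q-1}-1)\Big\rangle.$$ The algebraic set of an ideal $I$ of a polynomial ring over $\mathbb{F}_q$ in $n$ variables is the set of points of $\mathbb{F}_q^n$ at which all elements of $I$ vanish; $I$ is zero-dimensional if the quotient ring by $I$ is a finite-dimensional $\mathbb{F}_q$-vector space. -}

module Defs where

open import Level using (Level; _⊔_) renaming (suc to lsuc)
open import Algebra.Bundles using (CommutativeRing; Semiring)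
open import Algebra.Bundles.Raw using (RawRing)
import Algebra.Definitions.RawSemiring as RawSemiringDefs
open import Data.Bool.Base using (if_then_else_)
open import Data.Fin.Base as Fin using (Fin; toℕ; combine)
import Data.Fin.Properties as Fin
open import Data.List.Base as List using (List; []; _∷_; _++_)
open import Data.Nat.Base as ℕ using (ℕ; _∸_)
open import Data.Nat.Primality using (Prime)
open import Data.Nat.Properties using (_≟_)
open import Data.Product.Base using (Σ; Σ-syntax; ∃-syntax; _×_; _,_)
open import Data.Sum.Base using (_⊎_)
open import Data.Vec.Base as Vec using (Vec; []; _∷_)
open import Data.Vec.Functional using (Vector)
open import Data.Vec.Properties using (≡-dec)
open import Function.Bundles using (Bijection)
open import Function.Definitions using (Bijective)
open import Relation.Binary.Core using (Rel)
open import Relation.Binary.PropositionalEquality.Core using (_≡_)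
import Relation.Binary.PropositionalEquality.Properties as ≡
open import Relation.Nullary.Decidable.Core using (does)
open import Relation.Nullary.Negation.Core using (¬_)
open import Relation.Unary using (Pred)

IsPrimePower : ℕ → Set
IsPrimePower q = ∃[ p ] ∃[ k ] Prime p × 1 ℕ.≤ k × q ≡ p ℕ.^ k

record FiniteField (c ℓ : Level) (q : ℕ) : Set (lsuc (c ⊔ ℓ)) where
  field
    commutativeRing : CommutativeRing c ℓ

  open CommutativeRing commutativeRing public

  field
    1≉0         : ¬ 1# ≈ 0#
    inverse     : ∀ x → ¬ x ≈ 0# → ∃[ y ] x * y ≈ 1#
    cardinality : Bijection (≡.setoid (Fin q)) setoid

module Polynomials {c ℓ} (R : CommutativeRing c ℓ) where

  open CommutativeRing R
  open RawSemiringDefs (Semiring.rawSemiring semiring) using (_^_; product)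

  -- The monomial x₀^e₀ ⋯ xₙ₋₁^eₙ₋₁ is given by its exponent vector.
  Monomial : ℕ → Set
  Monomial n = Vec ℕ n

  -- A formal sum of terms.  Terms may repeat a monomial or have coefficient
  -- zero, so polynomials are compared by coefficients (_≈ᴾ_ below), never
  -- as lists.
  Poly : ℕ → Set c
  Poly n = List (Carrier × Monomial n)

  coeff : ∀ {n} → Poly n → Monomial n → Carrier
  coeff []            m = 0#
  coeff ((a , e) ∷ f) m =
    (if does (≡-dec _≟_ e m) then a else 0#) + coeff f m

  infix 4 _≈ᴾ_
  _≈ᴾ_ : ∀ {n} → Rel (Poly n) ℓ
  f ≈ᴾ g = ∀ m → coeff f m ≈ coeff g m

  negᴾ : ∀ {n} → Poly n → Poly n
  negᴾ = List.map λ { (a , e) → - a , e }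

  mulᴾ : ∀ {n} → Poly n → Poly n → Poly n
  mulᴾ f g = List.cartesianProductWith
    (λ { (a , e) (b , e′) → a * b , Vec.zipWith ℕ._+_ e e′ }) f g

  con : ∀ {n} → Carrier → Poly n
  con a = (a , Vec.replicate _ 0) ∷ []

  var : ∀ {n} → Fin n → Poly n
  var i = (1# , Vec.tabulate (λ j → if does (i Fin.≟ j) then 1 else 0)) ∷ []

  polyRawRing : ℕ → RawRing c ℓ
  polyRawRing n = record
    { Carrier = Poly n
    ; _≈_     = _≈ᴾ_
    ; _+_     = _++_
    ; _*_     = mulᴾ
    ; -_      = negᴾ
    ; 0#      = []
    ; 1#      = con 1#
    }

  eval : ∀ {n} → Poly n → Vector Carrier n → Carrier
  eval []            s = 0#
  eval ((a , e) ∷ f) s = a * product (λ i → s i ^ Vec.lookup e i) + eval f s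

  DegreeInEachVariable<_ : ∀ {n} → ℕ → Poly n → Set ℓ
  (DegreeInEachVariable< q) f =
    ∀ m → ¬ coeff f m ≈ 0# → ∀ i → Vec.lookup m i ℕ.< q

  HasTotalDegree : ∀ {n} → ℕ → Poly n → Set ℓ
  HasTotalDegree d f =
      (∀ m → ¬ coeff f m ≈ 0# → Vec.sum m ℕ.≤ d)
    × (∃[ m ] Vec.sum m ≡ d × ¬ coeff f m ≈ 0#)

  module Ideals (n : ℕ) where

    open RawRing (polyRawRing n) public
      using ()
      renaming (_+_ to _+ᴾ_; _*_ to _*ᴾ_; -_ to -ᴾ_; 0# to 0ᴾ; 1# to 1ᴾ)
    open RawSemiringDefs (RawRing.rawSemiring (polyRawRing n)) public
      using ()
      renaming (_^_ to _^ᴾ_; sum to ∑; product to ∏)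

    infixl 6 _-ᴾ_
    _-ᴾ_ : Poly n → Poly n → Poly n
    f -ᴾ g = f +ᴾ (-ᴾ g)

    ⟨_⟩ : ∀ {a} → Pred (Poly n) a → Pred (Poly n) (c ⊔ ℓ ⊔ a)
    ⟨ S ⟩ f = ∃[ k ] Σ[ h ∈ Vector (Poly n) k ] Σ[ g ∈ Vector (Poly n) k ]
      (∀ i → S (g i)) × f ≈ᴾ ∑ (λ i → h i *ᴾ g i)

    infixl 6 _+ᴵ_
    _+ᴵ_ : ∀ {a b} → Pred (Poly n) a → Pred (Poly n) b →
           Pred (Poly n) (c ⊔ ℓ ⊔ a ⊔ b)
    (I +ᴵ J) f = ∃[ g ] ∃[ h ] I g × J h × f ≈ᴾ g +ᴾ h

    -- The quotient by I is the setoid of polynomials with equality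
    -- f -ᴾ g ∈ I; zero-dimensional means that it has a finite basis over R.
    ZeroDimensional : ∀ {a} → Pred (Poly n) a → Set (c ⊔ ℓ ⊔ a)
    ZeroDimensional I = ∃[ k ] Σ[ b ∈ Vector (Poly n) k ]
        (∀ f → Σ[ r ∈ Vector Carrier k ] I (f -ᴾ ∑ (λ i → con (r i) *ᴾ b i)))
      × (∀ (r : Vector Carrier k) → I (∑ (λ i → con (r i) *ᴾ b i)) →
         ∀ i → r i ≈ 0#)

    Radical : ∀ {a} → Pred (Poly n) a → Set (c ⊔ a)
    Radical I = ∀ f k → I (f ^ᴾ k) → I f

    AlgebraicSet : ∀ {a} → Pred (Poly n) a → Pred (Vector Carrier n) (c ⊔ ℓ ⊔ a)
    AlgebraicSet I s = ∀ f → I f → eval f s ≈ 0#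

module LocalPermutation {c ℓ q} (K : FiniteField c ℓ q) where

  open FiniteField K
  open Polynomials commutativeRing public

  at : Poly 2 → Carrier → Carrier → Carrier
  at f a b = eval f (Vec.lookup (a ∷ b ∷ []))

  IsPermutation : (Carrier → Carrier) → Set (c ⊔ ℓ)
  IsPermutation = Bijective _≈_ _≈_

  -- f(x,y) ↦ f(y,x)
  swap : Poly 2 → Poly 2
  swap = List.map λ { (a , i ∷ j ∷ []) → a , j ∷ i ∷ [] }

  LP : Pred (Poly 2) (c ⊔ ℓ)
  LP f = (DegreeInEachVariable< q) f
       × (∀ a → IsPermutation (λ x → at f x a) × IsPermutation (λ x → at f a x))

  SLP : Pred (Poly 2) (c ⊔ ℓ)
  SLP f = LP f × f ≈ᴾ swap f

  SLPᵈ : ℕ → Pred (Poly 2) (c ⊔ ℓ)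
  SLPᵈ d f = SLP f × HasTotalDegree d f

  Index : Set
  Index = Fin (q ∸ 1)

  N : ℕ
  N = (q ∸ 1) ℕ.* (q ∸ 1)

  -- The variables x_ij are numbered by the bijection
  -- combine : Fin (q ∸ 1) × Fin (q ∸ 1) → Fin N.
  module X where

    open Ideals N public
    open RawSemiringDefs (Semiring.rawSemiring semiring) using (_^_)

    x : Index → Index → Poly N
    x i j = var (combine i j)

    F : Poly N → Poly N
    F f = f ^ᴾ (q ∸ 1) -ᴾ 1ᴾ

    Grow Gcol : Carrier → Carrier → Carrier → Poly N
    Grow a b c = F (∑ λ i → ∑ λ j →
      con ((a ^ toℕ i - b ^ toℕ i) * c ^ toℕ j) *ᴾ x j i)
    Gcol a b c = F (∑ λ i → ∑ λ j →
      con ((a ^ toℕ i - b ^ toℕ i) * c ^ toℕ j) *ᴾ x i j)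

    𝒥 : Pred (Poly N) (c ⊔ ℓ)
    𝒥 = ⟨ (λ f → ∃[ a ] ∃[ b ] ∃[ c ] ¬ a ≈ b × (f ≡ Grow a b c ⊎ f ≡ Gcol a b c)) ⟩
      +ᴵ ⟨ (λ f → ∃[ i ] ∃[ j ] f ≡ x i j ^ᴾ q -ᴾ x i j) ⟩

    -- ∏ (x_ij^(q-1) - 1) over the pairs of indices with i + j = d; the other
    -- pairs contribute a factor 1.
    antidiagonalProduct : ℕ → Poly N
    antidiagonalProduct d = ∏ λ i → ∏ λ j →
      if does (toℕ i ℕ.+ toℕ j ≟ d) then F (x i j) else 1ᴾ

    𝒥ᵈ : ℕ → Pred (Poly N) (c ⊔ ℓ)
    𝒥ᵈ d = 𝒥
      +ᴵ ⟨ (λ f → ∃[ i ] ∃[ j ] toℕ i ℕ.+ toℕ j ℕ.> d × f ≡ x i j) ⟩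
      +ᴵ ⟨ (λ f → f ≡ antidiagonalProduct d) ⟩

    symmetryIdeal : Pred (Poly N) (c ⊔ ℓ)
    symmetryIdeal = ⟨ (λ f → ∃[ i ] ∃[ j ] i Fin.< j × f ≡ x i j -ᴾ x j i) ⟩

  toPoly : Vector Carrier N → Poly 2
  toPoly s = ∑ λ (i : Index) → ∑ λ (j : Index) →
    con (s (combine i j)) *ᴾ var Fin.zero ^ᴾ toℕ i *ᴾ var (Fin.suc Fin.zero) ^ᴾ toℕ j
    where open Ideals 2

  -- toPoly maps the algebraic set of I into S, and the restricted map is a
  -- bijection.
  IdentifiedByCoefficients : ∀ {a b} → Pred (Poly N) a → Pred (Poly 2) b →
                             Set (c ⊔ ℓ ⊔ a ⊔ b)
  IdentifiedByCoefficients I S =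
    Σ[ inS ∈ (∀ s → X.AlgebraicSet I s → S (toPoly s)) ]
      Bijective {A = Σ (Vector Carrier N) (X.AlgebraicSet I)} {B = Σ (Poly 2) S}
        (λ (s , _) (t , _) → ∀ v → s v ≈ t v)
        (λ (f , _) (g , _) → f ≈ᴾ g)
        (λ (s , s∈V) → toPoly s , inS s s∈V)

{-# OPTIONS --safe #-}
module Submission where

-- Let I be an ideal containing x_v^q - x_v for all v.  Dividing these out and
-- splitting off one variable at a time, f = Σ_{i<q} x^i f_i, a polynomial that
-- vanishes on K^n lies in I, because a univariate polynomial of degree < q with
-- q roots is zero.  If f only vanishes on the zeros of g₁, …, gₘ ∈ I, the
-- product of f and all 1 - gⱼ^(q-1) vanishes everywhere and is congruent to f
-- modulo I, so f ∈ I.  Hence I is the ideal of all polynomials vanishing on its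
-- zeros: it is radical, and the indicator polynomials of its zeros form a
-- basis of the quotient.
--
-- A zero of G^row and G^col is a coefficient array whose polynomial is
-- injective in each variable.  Conversely, for a local permutation polynomial
-- f, Σ_a f(a, b) = Σ_a a = 0 while Σ_a a^i = 0 for i < q - 1, so the coefficient
-- of x^(q-1) vanishes as a function of b; by symmetry f has degree at most
-- q - 2 in both variables.

open import Defs
open import Level using (Level; _⊔_)
open import Algebra.Bundles using (CommutativeMonoid; CommutativeRing; Semiring)
import Algebra.Definitions.RawSemiring as RawSemiringDefs
import Algebra.Morphism.Construct.Identity as Identity
open import Algebra.Morphism.Structures using (module MonoidMorphisms)
import Algebra.Properties.CommutativeMonoid.Mult as MonoidMult
import Algebra.Properties.CommutativeMonoid.Sum as MonoidSum
import Algebra.Properties.CommutativeSemigroup as CommutativeSemigroupProperties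
import Algebra.Properties.CommutativeSemiring.Exp as ExpProperties
import Algebra.Properties.Ring as RingProperties
import Algebra.Properties.Semiring.Sum as SumProperties
open import Data.Bool.Base using (true; false; _∧_; if_then_else_)
open import Data.Fin.Base as Fin using (Fin; zero; suc; toℕ; _↑ˡ_; _↑ʳ_)
import Data.Fin.Permutation as Perm
import Data.Fin.Properties as Fin
open import Data.List.Base as List using (List; []; _∷_; _++_)
import Data.List.Properties as List
open import Data.List.Relation.Unary.All as All using (All; []; _∷_)
import Data.List.Relation.Unary.All.Properties as All
open import Data.Nat.Base as ℕ using (ℕ; z≤n; s≤s; _>_)
import Data.Nat.Properties as ℕ
open import Data.Product.Base using (Σ-syntax; ∃-syntax; _×_; _,_; proj₁; proj₂)
open import Data.Sum.Base using (_⊎_; inj₁; inj₂)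
open import Data.Vec.Base as Vec using (Vec; []; _∷_)
open import Data.Vec.Functional as Vector using (Vector)
import Data.Vec.Functional.Properties as Vector
import Data.Vec.Properties as Vec
open import Function.Base using (_∘_)
open import Function.Bundles using (Bijection)
open import Function.Definitions using (Injective)
open import Relation.Binary.Definitions using (Decidable; tri<; tri≈; tri>)
open import Relation.Binary.PropositionalEquality as ≡ using (_≡_)
import Relation.Binary.Reasoning.Setoid as SetoidReasoning
open import Relation.Nullary.Decidable
  using (Dec; yes; no; does; ¬?; dec-true; dec-false; decidable-stable)
open import Relation.Nullary.Negation using (¬_; contradiction)
open import Relation.Unary as Unary using (Pred)

-- Polynomials as a commutative ring

-- The splitting f = Σ x^i f_i is never proved as an identity of polynomials, where it holds only
-- modulo x^q - x. A polynomial is its own value at its variables, and in the quotient by I these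
-- satisfy x^q = x. So the splitting is needed only for values, at points with x^q = x in a ring A
-- that receives the coefficients. With A = K it shows that all f_i vanish everywhere on K; with A
-- the quotient it then gives f = 0 there, that is, f ∈ I. The other obstacle is that K is a setoid:
-- the generators `Grow a b c` and `Gcol a b c` are indexed by its whole carrier, in which a field
-- element may have many representatives. The argument with the factors 1 - g^(q-1) needs a finite
-- list of equations, so each ideal carries a finite list of members that has the same zeros.
-- Fermat's theorem turns `F` into a test for being nonzero, and it makes both these factors and the
-- indicator polynomials of points work.

infixl 6 _⊕_
_⊕_ : ∀ {n} → Vec ℕ n → Vec ℕ n → Vec ℕ n
_⊕_ = Vec.zipWith ℕ._+_

unit : ∀ {n} → Fin n → Vec ℕ n
unit i = Vec.tabulate (λ j → if does (i Fin.≟ j) then 1 else 0)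

tabulate-0 : ∀ n → Vec.tabulate {n = n} (λ _ → 0) ≡ Vec.replicate n 0
tabulate-0 ℕ.zero    = ≡.refl
tabulate-0 (ℕ.suc n) = ≡.cong (0 ∷_) (tabulate-0 n)

module MonoidHomomorphism {c ℓ} (M : CommutativeMonoid c ℓ) where

  open CommutativeMonoid M
  open MonoidSum M using (sum; sum-cong-≋; sum-replicate-zero)
  open MonoidMult M using () renaming (_×_ to _·_)
  open SetoidReasoning setoid

  sum-single : ∀ {n} (v : Fin n) (f : Fin n → Carrier) →
               (∀ j → ¬ v ≡ j → f j ≈ ε) → sum f ≈ f v
  sum-single {ℕ.suc n} zero f f≈ε = begin
    f zero ∙ sum (f ∘ suc) ≈⟨ ∙-congˡ (sum-cong-≋ (λ j → f≈ε (suc j) λ ())) ⟩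
    f zero ∙ sum {n} (λ _ → ε) ≈⟨ ∙-congˡ (sum-replicate-zero n) ⟩
    f zero ∙ ε             ≈⟨ identityʳ _ ⟩
    f zero                 ∎
  sum-single {ℕ.suc n} (suc v) f f≈ε = begin
    f zero ∙ sum (f ∘ suc)
      ≈⟨ ∙-cong (f≈ε zero λ ()) (sum-single v (f ∘ suc)
           λ j v≢j → f≈ε (suc j) (v≢j ∘ Fin.suc-injective)) ⟩
    ε ∙ f (suc v)          ≈⟨ identityˡ _ ⟩
    f (suc v)              ∎

  -- Exponent vectors form the free commutative monoid on the unit vectors, so a homomorphism out of
  -- them is determined by its values there. In a multiplicative monoid `k ·` is the k-th power, and
  -- this becomes the factorisation of a monomial into powers of variables.
  hom-unit : ∀ {n} (φ : Vec ℕ n → Carrier) → φ (Vec.replicate n 0) ≈ ε →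
             (∀ d e → φ (d ⊕ e) ≈ φ d ∙ φ e) →
             ∀ e → φ e ≈ sum (λ i → Vec.lookup e i · φ (unit i))
  hom-unit φ φ0 φ⊕ [] = φ0
  hom-unit {ℕ.suc n} φ φ0 φ⊕ (k ∷ e) = begin
    φ (k ∷ e)
      ≡⟨ ≡.cong₂ (λ k e → φ (k ∷ e)) (ℕ.+-identityʳ k)
           (Vec.zipWith-identityˡ (λ _ → ≡.refl) e) ⟨
    φ ((k ∷ Vec.replicate n 0) ⊕ (0 ∷ e))
      ≈⟨ φ⊕ _ _ ⟩
    φ (k ∷ Vec.replicate n 0) ∙ φ (0 ∷ e)
      ≈⟨ ∙-cong (multiple k) (hom-unit (φ ∘ (0 ∷_)) φ0 (λ d e → φ⊕ (0 ∷ d) (0 ∷ e)) e) ⟩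
    (k · φ (1 ∷ Vec.replicate n 0)) ∙ sum (λ i → Vec.lookup e i · φ (0 ∷ unit i))
      ≡⟨ ≡.cong (λ u → (k · φ (1 ∷ u)) ∙ sum (λ i → Vec.lookup e i · φ (0 ∷ unit i)))
           (tabulate-0 n) ⟨
    (k · φ (unit zero)) ∙ sum (λ i → Vec.lookup e i · φ (unit (suc i))) ∎
    where
    multiple : ∀ k → φ (k ∷ Vec.replicate n 0) ≈ k · φ (1 ∷ Vec.replicate n 0)
    multiple 0         = φ0
    multiple (ℕ.suc k) = begin
      φ (ℕ.suc k ∷ Vec.replicate n 0)
        ≡⟨ ≡.cong (λ e → φ (ℕ.suc k ∷ e)) (Vec.zipWith-identityˡ (λ _ → ≡.refl) _) ⟨
      φ ((1 ∷ Vec.replicate n 0) ⊕ (k ∷ Vec.replicate n 0))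
        ≈⟨ φ⊕ _ _ ⟩
      φ (1 ∷ Vec.replicate n 0) ∙ φ (k ∷ Vec.replicate n 0)
        ≈⟨ ∙-congˡ (multiple k) ⟩
      φ (1 ∷ Vec.replicate n 0) ∙ (k · φ (1 ∷ Vec.replicate n 0)) ∎

module PolynomialRing {c ℓ} (R : CommutativeRing c ℓ) where

  open CommutativeRing R hiding (zero)
  open RingProperties ring using (-0#≈0#; -‿distribˡ-*; -‿+-comm; x∙y⁻¹≈ε⇒x≈y)
  open CommutativeSemigroupProperties +-commutativeSemigroup using ()
    renaming (interchange to +-interchange)
  open CommutativeSemigroupProperties *-commutativeSemigroup using ()
    renaming (x∙yz≈y∙xz to *-swapˡ)
  open Polynomials R
  open SetoidReasoning setoid

  private variable
    n : ℕ

  -- The linear extension of φ to formal sums.  Coefficients, products and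
  -- evaluations are all of this form, which reduces polynomial identities to
  -- identities between monomials.
  lin : Poly n → (Monomial n → Carrier) → Carrier
  lin []            φ = 0#
  lin ((a , e) ∷ f) φ = a * φ e + lin f φ

  lin-cong : ∀ (f : Poly n) {φ ψ} → (∀ e → φ e ≈ ψ e) → lin f φ ≈ lin f ψ
  lin-cong []            φ≈ψ = refl
  lin-cong ((a , e) ∷ f) φ≈ψ = +-cong (*-congˡ (φ≈ψ e)) (lin-cong f φ≈ψ)

  lin-++ : ∀ (f g : Poly n) φ → lin (f ++ g) φ ≈ lin f φ + lin g φ
  lin-++ []            g φ = sym (+-identityˡ _)
  lin-++ ((a , e) ∷ f) g φ = trans (+-congˡ (lin-++ f g φ)) (sym (+-assoc _ _ _))

  lin-neg : ∀ (f : Poly n) φ → lin (negᴾ f) φ ≈ - lin f φ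
  lin-neg []            φ = sym -0#≈0#
  lin-neg ((a , e) ∷ f) φ = trans
    (+-cong (sym (-‿distribˡ-* a _)) (lin-neg f φ)) (-‿+-comm _ _)

  lin-* : ∀ (f : Poly n) a φ → lin f (λ e → a * φ e) ≈ a * lin f φ
  lin-* []            b φ = sym (zeroʳ b)
  lin-* ((a , e) ∷ f) b φ = trans
    (+-cong (*-swapˡ a b _) (lin-* f b φ)) (sym (distribˡ b _ _))

  lin-+ : ∀ (f : Poly n) φ ψ → lin f (λ e → φ e + ψ e) ≈ lin f φ + lin f ψ
  lin-+ []            φ ψ = sym (+-identityˡ 0#)
  lin-+ ((a , e) ∷ f) φ ψ = trans
    (+-cong (distribˡ a _ _) (lin-+ f φ ψ)) (+-interchange _ _ _ _)

  lin-0 : ∀ (f : Poly n) → lin f (λ _ → 0#) ≈ 0#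
  lin-0 []            = refl
  lin-0 ((a , e) ∷ f) = trans (+-cong (zeroʳ a) (lin-0 f)) (+-identityˡ 0#)

  lin-comm : ∀ {m} (f : Poly n) (g : Poly m) (Φ : Monomial n → Monomial m → Carrier) →
             lin f (λ d → lin g (Φ d)) ≈ lin g (λ e → lin f (λ d → Φ d e))
  lin-comm []            g Φ = sym (lin-0 g)
  lin-comm ((a , d) ∷ f) g Φ = begin
    a * lin g (Φ d) + lin f (λ d → lin g (Φ d))
      ≈⟨ +-cong (sym (lin-* g a _)) (lin-comm f g Φ) ⟩
    lin g (λ e → a * Φ d e) + lin g (λ e → lin f (λ d → Φ d e))
      ≈⟨ lin-+ g _ _ ⟨
    lin g (λ e → a * Φ d e + lin f (λ d → Φ d e)) ∎

  -- The function mapped over `g` inside `mulᴾ` is a pattern-matching lambda, which cannot be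
  -- written down again here. Hence `h` is any function with the right values, and unification
  -- supplies it in `lin-mul`.
  lin-scaleShift : ∀ a d (h : Carrier × Monomial n → Carrier × Monomial n) →
                   (∀ b e → h (b , e) ≡ (a * b , d ⊕ e)) → ∀ g φ →
                   lin (List.map h g) φ ≈ a * lin g (λ e → φ (d ⊕ e))
  lin-scaleShift a d h h≡ []            φ = sym (zeroʳ a)
  lin-scaleShift a d h h≡ ((b , e) ∷ g) φ rewrite h≡ b e = trans
    (+-cong (*-assoc a b _) (lin-scaleShift a d h h≡ g φ)) (sym (distribˡ a _ _))

  lin-mul : ∀ (f g : Poly n) φ →
            lin (mulᴾ f g) φ ≈ lin f (λ d → lin g (λ e → φ (d ⊕ e)))
  lin-mul []            g φ = refl
  lin-mul ((a , d) ∷ f) g φ = trans (lin-++ (List.map _ g) _ φ)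
    (+-cong (lin-scaleShift a d _ (λ _ _ → ≡.refl) g φ) (lin-mul f g φ))

  δ : Monomial n → Monomial n → Carrier
  δ m e = if does (Vec.≡-dec ℕ._≟_ e m) then 1# else 0#

  coeff-lin : ∀ (f : Poly n) m → coeff f m ≈ lin f (δ m)
  coeff-lin []            m = refl
  coeff-lin ((a , e) ∷ f) m with does (Vec.≡-dec ℕ._≟_ e m)
  ... | true  = +-cong (sym (*-identityʳ a)) (coeff-lin f m)
  ... | false = +-cong (sym (zeroʳ a)) (coeff-lin f m)

  delete : Monomial n → Poly n → Poly n
  delete d []            = []
  delete d ((a , e) ∷ f) with Vec.≡-dec ℕ._≟_ e d
  ... | yes _ = delete d f
  ... | no  _ = (a , e) ∷ delete d f

  length-delete : ∀ d (f : Poly n) → List.length (delete d f) ℕ.≤ List.length f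
  length-delete d []            = z≤n
  length-delete d ((a , e) ∷ f) with Vec.≡-dec ℕ._≟_ e d
  ... | yes _ = ℕ.m≤n⇒m≤1+n (length-delete d f)
  ... | no  _ = s≤s (length-delete d f)

  lin-delete : ∀ d (f : Poly n) φ → lin f φ ≈ coeff f d * φ d + lin (delete d f) φ
  lin-delete d []            φ = sym (trans (+-identityʳ _) (zeroˡ _))
  lin-delete d ((a , e) ∷ f) φ with Vec.≡-dec ℕ._≟_ e d
  ... | yes ≡.refl = begin
    a * φ e + lin f φ                                     ≈⟨ +-congˡ (lin-delete d f φ) ⟩
    a * φ e + (coeff f e * φ e + lin (delete e f) φ)      ≈⟨ +-assoc _ _ _ ⟨
    (a * φ e + coeff f e * φ e) + lin (delete e f) φ      ≈⟨ +-congʳ (distribʳ _ _ _) ⟨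
    (a + coeff f e) * φ e + lin (delete e f) φ            ∎
  ... | no _ = begin
    a * φ e + lin f φ                                     ≈⟨ +-congˡ (lin-delete d f φ) ⟩
    a * φ e + (coeff f d * φ d + lin (delete d f) φ)      ≈⟨ +-assoc _ _ _ ⟨
    (a * φ e + coeff f d * φ d) + lin (delete d f) φ      ≈⟨ +-congʳ (+-comm _ _) ⟩
    (coeff f d * φ d + a * φ e) + lin (delete d f) φ      ≈⟨ +-assoc _ _ _ ⟩
    coeff f d * φ d + (a * φ e + lin (delete d f) φ)
      ≈⟨ +-congʳ (*-congʳ (sym (+-identityˡ _))) ⟩
    (0# + coeff f d) * φ d + (a * φ e + lin (delete d f) φ) ∎

  delete-vanish : ∀ d (f : Poly n) → f ≈ᴾ [] → delete d f ≈ᴾ []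
  delete-vanish d f f≈0 m = begin
    coeff (delete d f) m                     ≈⟨ coeff-lin (delete d f) m ⟩
    lin (delete d f) (δ m)                   ≈⟨ +-identityˡ _ ⟨
    0# + lin (delete d f) (δ m)
      ≈⟨ +-congʳ (trans (*-congʳ (f≈0 d)) (zeroˡ _)) ⟨
    coeff f d * δ m d + lin (delete d f) (δ m) ≈⟨ lin-delete d f (δ m) ⟨
    lin f (δ m)                              ≈⟨ coeff-lin f m ⟨
    coeff f m                                ≈⟨ f≈0 m ⟩
    0#                                       ∎

  -- The test of `d` against itself does not reduce for an open `d`. That the head goes away is what
  -- makes the length drop in `lin-vanish`.
  delete-head : ∀ a d (f : Poly n) → delete d ((a , d) ∷ f) ≡ delete d f
  delete-head a d f with Vec.≡-dec ℕ._≟_ d d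
  ... | yes _   = ≡.refl
  ... | no  d≢d = contradiction ≡.refl d≢d

  -- Deleting the terms with exponent d removes coeff f d · φ d = 0 from lin f φ,
  -- which gives an induction on the length of f.
  lin-vanish : ∀ k (f : Poly n) → List.length f ℕ.≤ k → f ≈ᴾ [] → ∀ φ → lin f φ ≈ 0#
  lin-vanish k         []               _         f≈0 φ = refl
  lin-vanish (ℕ.suc k) f@((a , d) ∷ f′) (s≤s ∣f∣≤k) f≈0 φ = begin
    lin f φ                              ≈⟨ lin-delete d f φ ⟩
    coeff f d * φ d + lin (delete d f) φ
      ≈⟨ +-cong (trans (*-congʳ (f≈0 d)) (zeroˡ _))
           (lin-vanish k (delete d f) ∣delete∣≤k (delete-vanish d f f≈0) φ) ⟩
    0# + 0#                              ≈⟨ +-identityˡ 0# ⟩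
    0#                                   ∎
    where
    ∣delete∣≤k : List.length (delete d f) ℕ.≤ k
    ∣delete∣≤k = ≡.subst (λ h → List.length h ℕ.≤ k) (≡.sym (delete-head a d f′))
      (ℕ.≤-trans (length-delete d f′) ∣f∣≤k)

  -- _≈ᴾ_ as a record, so that unification recovers f and g from f ≋ g.
  infix 4 _≋_
  record _≋_ (f g : Poly n) : Set ℓ where
    constructor mk≋
    field coeff-≈ : f ≈ᴾ g

  open _≋_ public

  ≋-intro : ∀ {f g : Poly n} → (∀ φ → lin f φ ≈ lin g φ) → f ≋ g
  ≋-intro {f = f} {g} f≈g = mk≋ λ m →
    trans (coeff-lin f m) (trans (f≈g (δ m)) (sym (coeff-lin g m)))

  ≋-refl : ∀ {f : Poly n} → f ≋ f
  ≋-refl = mk≋ λ _ → refl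

  ≋-sym : ∀ {f g : Poly n} → f ≋ g → g ≋ f
  ≋-sym (mk≋ p) = mk≋ λ m → sym (p m)

  ≋-trans : ∀ {f g h : Poly n} → f ≋ g → g ≋ h → f ≋ h
  ≋-trans (mk≋ p) (mk≋ q) = mk≋ λ m → trans (p m) (q m)

  ≡⇒≋ : ∀ {f g : Poly n} → f ≡ g → f ≋ g
  ≡⇒≋ ≡.refl = ≋-refl

  -- Applied to the difference `f ++ negᴾ g`, `lin-vanish` shows that linear extensions depend only
  -- on coefficients. With `≋-intro` this makes `f ≋ g` the same as agreement under all `φ`, which
  -- is how every ring law below is checked.
  lin-resp : ∀ {f g : Poly n} → f ≋ g → ∀ φ → lin f φ ≈ lin g φ
  lin-resp {f = f} {g} (mk≋ f≈g) φ = x∙y⁻¹≈ε⇒x≈y _ _ (begin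
    lin f φ - lin g φ       ≈⟨ +-congˡ (lin-neg g φ) ⟨
    lin f φ + lin (negᴾ g) φ ≈⟨ lin-++ f (negᴾ g) φ ⟨
    lin (f ++ negᴾ g) φ     ≈⟨ lin-vanish _ (f ++ negᴾ g) ℕ.≤-refl difference φ ⟩
    0#                      ∎)
    where
    difference : f ++ negᴾ g ≈ᴾ []
    difference m = begin
      coeff (f ++ negᴾ g) m             ≈⟨ coeff-lin (f ++ negᴾ g) m ⟩
      lin (f ++ negᴾ g) (δ m)           ≈⟨ lin-++ f (negᴾ g) (δ m) ⟩
      lin f (δ m) + lin (negᴾ g) (δ m)
        ≈⟨ +-cong (sym (coeff-lin f m)) (lin-neg g (δ m)) ⟩
      coeff f m - lin g (δ m)           ≈⟨ +-cong (f≈g m) (-‿cong (sym (coeff-lin g m))) ⟩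
      coeff g m - coeff g m             ≈⟨ -‿inverseʳ _ ⟩
      0#                                ∎

  lin-con : ∀ a (φ : Monomial n → Carrier) → lin (con a) φ ≈ a * φ (Vec.replicate n 0)
  lin-con a φ = +-identityʳ _

  ++-cong : ∀ {f f′ g g′ : Poly n} → f ≋ f′ → g ≋ g′ → f ++ g ≋ f′ ++ g′
  ++-cong {f = f} {f′} {g} {g′} f≈f′ g≈g′ = ≋-intro λ φ → begin
    lin (f ++ g) φ      ≈⟨ lin-++ f g φ ⟩
    lin f φ + lin g φ   ≈⟨ +-cong (lin-resp f≈f′ φ) (lin-resp g≈g′ φ) ⟩
    lin f′ φ + lin g′ φ ≈⟨ lin-++ f′ g′ φ ⟨
    lin (f′ ++ g′) φ    ∎

  mul-cong : ∀ {f f′ g g′ : Poly n} → f ≋ f′ → g ≋ g′ → mulᴾ f g ≋ mulᴾ f′ g′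
  mul-cong {f = f} {f′} {g} {g′} f≈f′ g≈g′ = ≋-intro λ φ → begin
    lin (mulᴾ f g) φ                         ≈⟨ lin-mul f g φ ⟩
    lin f (λ d → lin g (λ e → φ (d ⊕ e)))    ≈⟨ lin-resp f≈f′ _ ⟩
    lin f′ (λ d → lin g (λ e → φ (d ⊕ e)))   ≈⟨ lin-cong f′ (λ d → lin-resp g≈g′ _) ⟩
    lin f′ (λ d → lin g′ (λ e → φ (d ⊕ e)))  ≈⟨ lin-mul f′ g′ φ ⟨
    lin (mulᴾ f′ g′) φ                       ∎

  mul-assoc : ∀ (f g h : Poly n) → mulᴾ (mulᴾ f g) h ≋ mulᴾ f (mulᴾ g h)
  mul-assoc f g h = ≋-intro λ φ → begin
    lin (mulᴾ (mulᴾ f g) h) φ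
      ≈⟨ lin-mul (mulᴾ f g) h φ ⟩
    lin (mulᴾ f g) (λ d → lin h (λ e → φ (d ⊕ e)))
      ≈⟨ lin-mul f g _ ⟩
    lin f (λ d → lin g (λ e → lin h (λ k → φ (d ⊕ e ⊕ k))))
      ≈⟨ lin-cong f (λ d → lin-cong g λ e → lin-cong h λ k →
           reflexive (≡.cong φ (Vec.zipWith-assoc ℕ.+-assoc d e k))) ⟩
    lin f (λ d → lin g (λ e → lin h (λ k → φ (d ⊕ (e ⊕ k)))))
      ≈⟨ lin-cong f (λ d → lin-mul g h _) ⟨
    lin f (λ d → lin (mulᴾ g h) (λ e → φ (d ⊕ e)))
      ≈⟨ lin-mul f (mulᴾ g h) φ ⟨
    lin (mulᴾ f (mulᴾ g h)) φ ∎

  mul-comm : ∀ (f g : Poly n) → mulᴾ f g ≋ mulᴾ g f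
  mul-comm f g = ≋-intro λ φ → begin
    lin (mulᴾ f g) φ                       ≈⟨ lin-mul f g φ ⟩
    lin f (λ d → lin g (λ e → φ (d ⊕ e)))  ≈⟨ lin-comm f g _ ⟩
    lin g (λ e → lin f (λ d → φ (d ⊕ e)))
      ≈⟨ lin-cong g (λ e → lin-cong f λ d →
           reflexive (≡.cong φ (Vec.zipWith-comm ℕ.+-comm d e))) ⟩
    lin g (λ e → lin f (λ d → φ (e ⊕ d)))  ≈⟨ lin-mul g f φ ⟨
    lin (mulᴾ g f) φ                       ∎

  mul-identityˡ : ∀ (f : Poly n) → mulᴾ (con 1#) f ≋ f
  mul-identityˡ f = ≋-intro λ φ → begin
    lin (mulᴾ (con 1#) f) φ                       ≈⟨ lin-mul (con 1#) f φ ⟩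
    lin (con 1#) (λ d → lin f (λ e → φ (d ⊕ e)))  ≈⟨ lin-con 1# (λ d → lin f (λ e → φ (d ⊕ e))) ⟩
    1# * lin f (λ e → φ (Vec.replicate _ 0 ⊕ e))  ≈⟨ *-identityˡ _ ⟩
    lin f (λ e → φ (Vec.replicate _ 0 ⊕ e))
      ≈⟨ lin-cong f (λ e → reflexive (≡.cong φ
           (Vec.zipWith-identityˡ (λ _ → ≡.refl) e))) ⟩
    lin f φ ∎

  mul-distribˡ : ∀ (f g h : Poly n) → mulᴾ f (g ++ h) ≋ mulᴾ f g ++ mulᴾ f h
  mul-distribˡ f g h = ≋-intro λ φ → begin
    lin (mulᴾ f (g ++ h)) φ
      ≈⟨ lin-mul f (g ++ h) φ ⟩
    lin f (λ d → lin (g ++ h) (λ e → φ (d ⊕ e)))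
      ≈⟨ lin-cong f (λ d → lin-++ g h _) ⟩
    lin f (λ d → lin g (λ e → φ (d ⊕ e)) + lin h (λ e → φ (d ⊕ e)))
      ≈⟨ lin-+ f _ _ ⟩
    lin f (λ d → lin g (λ e → φ (d ⊕ e))) + lin f (λ d → lin h (λ e → φ (d ⊕ e)))
      ≈⟨ +-cong (lin-mul f g φ) (lin-mul f h φ) ⟨
    lin (mulᴾ f g) φ + lin (mulᴾ f h) φ
      ≈⟨ lin-++ (mulᴾ f g) (mulᴾ f h) φ ⟨
    lin (mulᴾ f g ++ mulᴾ f h) φ ∎

  neg-cong : ∀ {f g : Poly n} → f ≋ g → negᴾ f ≋ negᴾ g
  neg-cong {f = f} {g} f≈g = ≋-intro λ φ →
    trans (lin-neg f φ) (trans (-‿cong (lin-resp f≈g φ)) (sym (lin-neg g φ)))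

  ++-comm : ∀ (f g : Poly n) → f ++ g ≋ g ++ f
  ++-comm f g = ≋-intro λ φ →
    trans (lin-++ f g φ) (trans (+-comm _ _) (sym (lin-++ g f φ)))

  neg-inverseʳ : ∀ (f : Poly n) → f ++ negᴾ f ≋ []
  neg-inverseʳ f = ≋-intro λ φ → trans (lin-++ f (negᴾ f) φ)
    (trans (+-congˡ (lin-neg f φ)) (-‿inverseʳ _))

  polyRing : ℕ → CommutativeRing c ℓ
  polyRing n = record
    { Carrier = Poly n
    ; _≈_     = _≋_
    ; _+_     = _++_
    ; _*_     = mulᴾ
    ; -_      = negᴾ
    ; 0#      = []
    ; 1#      = con 1#
    ; isCommutativeRing = record
      { isRing = record
        { +-isAbelianGroup = record
          { isGroup = record
            { isMonoid = record
              { isSemigroup = record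
                { isMagma = record
                  { isEquivalence = record
                    { refl  = ≋-refl
                    ; sym   = ≋-sym
                    ; trans = ≋-trans
                    }
                  ; ∙-cong = ++-cong
                  }
                ; assoc = λ f g h → ≡⇒≋ (List.++-assoc f g h)
                }
              ; identity = (λ f → ≋-refl) , λ f → ≡⇒≋ (List.++-identityʳ f)
              }
            ; inverse = (λ f → ≋-trans (++-comm (negᴾ f) f) (neg-inverseʳ f))
                      , neg-inverseʳ
            ; ⁻¹-cong = neg-cong
            }
          ; comm = ++-comm
          }
        ; *-cong     = mul-cong
        ; *-assoc    = mul-assoc
        ; *-identity = mul-identityˡ
                     , λ f → ≋-trans (mul-comm f (con 1#)) (mul-identityˡ f)
        ; distrib    = mul-distribˡ
                     , λ f g h → ≋-trans (mul-comm (g ++ h) f)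
                         (≋-trans (mul-distribˡ f g h)
                           (++-cong (mul-comm f g) (mul-comm f h)))
        }
      ; *-comm = mul-comm
      }
    }

-- Evaluation of polynomials at points

module Evaluation {c ℓ} (R : CommutativeRing c ℓ) where

  open CommutativeRing R hiding (zero)
  open Polynomials R
  open PolynomialRing R
  open ExpProperties commutativeSemiring using (_^_; ^-homo-*; ^-congˡ; ^-congʳ)
  open RawSemiringDefs (Semiring.rawSemiring semiring) using (sum; product)
  open MonoidSum *-commutativeMonoid using ()
    renaming (sum-cong-≋ to product-cong; ∑-distrib-+ to product-distrib;
              sum-replicate-zero to product-1)
  open MonoidHomomorphism *-commutativeMonoid using ()
    renaming (sum-single to product-single)
  open SetoidReasoning setoid

  private variable
    n : ℕ

  point : Vector Carrier n → Monomial n → Carrier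
  point s e = product (λ i → s i ^ Vec.lookup e i)

  eval-lin : ∀ (f : Poly n) s → eval f s ≡ lin f (point s)
  eval-lin []            s = ≡.refl
  eval-lin ((a , e) ∷ f) s = ≡.cong (a * point s e +_) (eval-lin f s)

  point-0 : ∀ (s : Vector Carrier n) → point s (Vec.replicate n 0) ≈ 1#
  point-0 {n} s = trans
    (product-cong (λ i → ^-congʳ (s i) (Vec.lookup-replicate i 0))) (product-1 n)

  point-⊕ : ∀ (s : Vector Carrier n) d e → point s (d ⊕ e) ≈ point s d * point s e
  point-⊕ s d e = trans
    (product-cong (λ i → trans (^-congʳ (s i) (Vec.lookup-zipWith ℕ._+_ i d e))
      (^-homo-* (s i) (Vec.lookup d i) (Vec.lookup e i))))
    (product-distrib (λ i → s i ^ Vec.lookup d i) (λ i → s i ^ Vec.lookup e i))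

  point-cong : ∀ {s t : Vector Carrier n} → (∀ i → s i ≈ t i) →
               ∀ e → point s e ≈ point t e
  point-cong s≈t e = product-cong (λ i → ^-congˡ (Vec.lookup e i) (s≈t i))

  eval-cong : ∀ {f g : Poly n} → f ≋ g → ∀ s → eval f s ≈ eval g s
  eval-cong {f = f} {g} f≋g s = begin
    eval f s          ≡⟨ eval-lin f s ⟩
    lin f (point s)   ≈⟨ lin-resp f≋g _ ⟩
    lin g (point s)   ≡⟨ eval-lin g s ⟨
    eval g s          ∎

  eval-congʳ : ∀ (f : Poly n) {s t} → (∀ i → s i ≈ t i) → eval f s ≈ eval f t
  eval-congʳ f {s} {t} s≈t = begin
    eval f s          ≡⟨ eval-lin f s ⟩
    lin f (point s)   ≈⟨ lin-cong f (point-cong s≈t) ⟩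
    lin f (point t)   ≡⟨ eval-lin f t ⟨
    eval f t          ∎

  eval-+ : ∀ (f g : Poly n) s → eval (f ++ g) s ≈ eval f s + eval g s
  eval-+ f g s = begin
    eval (f ++ g) s                   ≡⟨ eval-lin (f ++ g) s ⟩
    lin (f ++ g) (point s)            ≈⟨ lin-++ f g _ ⟩
    lin f (point s) + lin g (point s) ≡⟨ ≡.cong₂ _+_ (eval-lin f s) (eval-lin g s) ⟨
    eval f s + eval g s               ∎

  eval-neg : ∀ (f : Poly n) s → eval (negᴾ f) s ≈ - eval f s
  eval-neg f s = begin
    eval (negᴾ f) s        ≡⟨ eval-lin (negᴾ f) s ⟩
    lin (negᴾ f) (point s) ≈⟨ lin-neg f _ ⟩
    - lin f (point s)      ≡⟨ ≡.cong -_ (eval-lin f s) ⟨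
    - eval f s             ∎

  eval-* : ∀ (f g : Poly n) s → eval (mulᴾ f g) s ≈ eval f s * eval g s
  eval-* f g s = begin
    eval (mulᴾ f g) s
      ≡⟨ eval-lin (mulᴾ f g) s ⟩
    lin (mulᴾ f g) (point s)
      ≈⟨ lin-mul f g _ ⟩
    lin f (λ d → lin g (λ e → point s (d ⊕ e)))
      ≈⟨ lin-cong f (λ d → trans (lin-cong g (point-⊕ s d))
           (trans (lin-* g (point s d) (point s)) (*-comm _ _))) ⟩
    lin f (λ d → lin g (point s) * point s d)
      ≈⟨ lin-* f _ _ ⟩
    lin g (point s) * lin f (point s)
      ≈⟨ *-comm _ _ ⟩
    lin f (point s) * lin g (point s)
      ≡⟨ ≡.cong₂ _*_ (eval-lin f s) (eval-lin g s) ⟨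
    eval f s * eval g s ∎

  eval-con : ∀ a (s : Vector Carrier n) → eval (con a) s ≈ a
  eval-con a s = trans (+-identityʳ _) (trans (*-congˡ (point-0 s)) (*-identityʳ a))

  eval-var : ∀ v (s : Vector Carrier n) → eval (var v) s ≈ s v
  eval-var v s = begin
    1# * point s (unit v) + 0#  ≈⟨ +-identityʳ _ ⟩
    1# * point s (unit v)       ≈⟨ *-identityˡ _ ⟩
    point s (unit v)
      ≈⟨ product-single v _ (λ j v≢j → ^-congʳ (s j) (≡.trans (entry j)
           (≡.cong (if_then 1 else 0) (dec-false (v Fin.≟ j) v≢j)))) ⟩
    s v ^ Vec.lookup (unit v) v
      ≈⟨ ^-congʳ (s v) (≡.trans (entry v)
           (≡.cong (if_then 1 else 0) (dec-true (v Fin.≟ v) ≡.refl))) ⟩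
    s v ^ 1                     ≈⟨ *-identityʳ _ ⟩
    s v                         ∎
    where
    entry : ∀ j → Vec.lookup (unit v) j ≡ (if does (v Fin.≟ j) then 1 else 0)
    entry = Vec.lookup∘tabulate _

  module _ {n : ℕ} where
    open Ideals n

    eval-^ : ∀ (f : Poly n) k s → eval (f ^ᴾ k) s ≈ eval f s ^ k
    eval-^ f 0         s = eval-con 1# s
    eval-^ f (ℕ.suc k) s = trans (eval-* f (f ^ᴾ k) s) (*-congˡ (eval-^ f k s))

    eval-minus : ∀ (f g : Poly n) s → eval (f -ᴾ g) s ≈ eval f s - eval g s
    eval-minus f g s = trans (eval-+ f (negᴾ g) s) (+-congˡ (eval-neg g s))

    eval-∑ : ∀ {k} (f : Vector (Poly n) k) s → eval (∑ f) s ≈ sum (λ i → eval (f i) s)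
    eval-∑ {0}       f s = refl
    eval-∑ {ℕ.suc k} f s = trans (eval-+ (f zero) (∑ (f ∘ suc)) s)
      (+-congˡ (eval-∑ (f ∘ suc) s))

    eval-∏ : ∀ {k} (f : Vector (Poly n) k) s → eval (∏ f) s ≈ product (λ i → eval (f i) s)
    eval-∏ {0}       f s = eval-con 1# s
    eval-∏ {ℕ.suc k} f s = trans (eval-* (f zero) (∏ (f ∘ suc)) s)
      (*-congˡ (eval-∏ (f ∘ suc) s))

  module _ (n : ℕ) where
    private
      module P = CommutativeRing (polyRing n)
      module Pₑ = ExpProperties P.commutativeSemiring
    open Ideals n
    open MonoidHomomorphism P.*-commutativeMonoid using (hom-unit)
    open MonoidSum P.*-commutativeMonoid using (sum-cong-≗)

    -- The two powers are built over raw monoids that differ in _≈_, so they are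
    -- not convertible for a variable exponent.
    ^ᴾ≡^ : ∀ f k → f ^ᴾ k ≡ f Pₑ.^ k
    ^ᴾ≡^ f 0         = ≡.refl
    ^ᴾ≡^ f (ℕ.suc k) = ≡.cong (mulᴾ f) (^ᴾ≡^ f k)

    -- This is `hom-unit` for the map that sends an exponent vector to its monic monomial, viewed in
    -- the multiplicative monoid of polynomials.
    term≋ : ∀ a (e : Monomial n) →
            (a , e) ∷ [] ≋ con a *ᴾ ∏ (λ i → var i ^ᴾ Vec.lookup e i)
    term≋ a e = P.trans
      (≋-intro λ φ → begin
        a * φ e + 0#                     ≈⟨ +-congʳ (*-congʳ (*-identityʳ a)) ⟨
        a * 1# * φ e + 0#
          ≡⟨ ≡.cong (λ d → a * 1# * φ d + 0#) (Vec.zipWith-identityˡ (λ _ → ≡.refl) e) ⟨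
        a * 1# * φ (Vec.replicate n 0 ⊕ e) + 0# ∎)
      (P.*-congˡ {con a} (P.trans
        (hom-unit (λ d → (1# , d) ∷ []) P.refl
          (λ d d′ → ≋-intro λ φ → +-congʳ (*-congʳ (sym (*-identityʳ 1#)))) e)
        (≡⇒≋ (sum-cong-≗ (λ i → ≡.sym (^ᴾ≡^ (var i) (Vec.lookup e i)))))))

-- Ideals and quotient rings

record IsIdeal {c ℓ a} (R : CommutativeRing c ℓ)
               (I : Pred (CommutativeRing.Carrier R) a) : Set (c ⊔ ℓ ⊔ a) where
  open CommutativeRing R hiding (zero)
  field
    resp     : ∀ {f g} → f ≈ g → I f → I g
    0∈       : I 0#
    +-closed : ∀ {f g} → I f → I g → I (f + g)
    *-closed : ∀ h {f} → I f → I (h * f)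

  neg-closed : ∀ {f} → I f → I (- f)
  neg-closed {f} f∈I = resp (-1*x≈-x f) (*-closed (- 1#) f∈I)
    where open RingProperties ring

module Quotient {c ℓ a} (R : CommutativeRing c ℓ)
                {I : Pred (CommutativeRing.Carrier R) a} (I-ideal : IsIdeal R I) where

  open CommutativeRing R hiding (zero)
  open IsIdeal I-ideal
  open RingProperties ring
    using (-0#≈0#; -‿+-comm; -‿involutive; x[y-z]≈xy-xz)
  open CommutativeSemigroupProperties +-commutativeSemigroup using (interchange)
  open SetoidReasoning setoid

  infix 4 _∼_
  record _∼_ (f g : Carrier) : Set a where
    constructor mk∼
    field difference : I (f - g)

  open _∼_ public

  ≈⇒∼ : ∀ {f g} → f ≈ g → f ∼ g
  ≈⇒∼ {f} {g} f≈g = mk∼ (resp (sym (trans (+-congʳ f≈g) (-‿inverseʳ g))) 0∈)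

  ∼-sym : ∀ {f g} → f ∼ g → g ∼ f
  ∼-sym {f} {g} (mk∼ p) = mk∼ (resp (begin
    - (f - g)     ≈⟨ -‿+-comm f (- g) ⟨
    - f - - g     ≈⟨ +-congˡ (-‿involutive g) ⟩
    - f + g       ≈⟨ +-comm _ _ ⟩
    g - f         ∎) (neg-closed p))

  ∼-trans : ∀ {f g h} → f ∼ g → g ∼ h → f ∼ h
  ∼-trans {f} {g} {h} (mk∼ p) (mk∼ q) = mk∼ (resp (begin
    (f - g) + (g - h)   ≈⟨ +-assoc _ _ _ ⟩
    f + (- g + (g - h)) ≈⟨ +-congˡ (+-assoc _ _ _) ⟨
    f + (- g + g - h)   ≈⟨ +-congˡ (+-congʳ (-‿inverseˡ g)) ⟩
    f + (0# - h)        ≈⟨ +-congˡ (+-identityˡ _) ⟩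
    f - h               ∎) (+-closed p q))

  ∼-+ : ∀ {f f′ g g′} → f ∼ f′ → g ∼ g′ → f + g ∼ f′ + g′
  ∼-+ {f} {f′} {g} {g′} (mk∼ p) (mk∼ q) = mk∼ (resp (begin
    (f - f′) + (g - g′)     ≈⟨ interchange _ _ _ _ ⟩
    (f + g) + (- f′ - g′)   ≈⟨ +-congˡ (-‿+-comm f′ g′) ⟩
    (f + g) - (f′ + g′)     ∎) (+-closed p q))

  ∼-neg : ∀ {f g} → f ∼ g → - f ∼ - g
  ∼-neg {f} {g} (mk∼ p) = mk∼ (resp (sym (-‿+-comm f (- g))) (neg-closed p))

  ∼-*ˡ : ∀ h {f g} → f ∼ g → h * f ∼ h * g
  ∼-*ˡ h {f} {g} (mk∼ p) = mk∼ (resp (x[y-z]≈xy-xz h f g) (*-closed h p))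

  ∼-* : ∀ {f f′ g g′} → f ∼ f′ → g ∼ g′ → f * g ∼ f′ * g′
  ∼-* {f} {f′} {g} {g′} p q = ∼-trans (∼-*ˡ f q)
    (∼-trans (≈⇒∼ (*-comm f g′)) (∼-trans (∼-*ˡ g′ p) (≈⇒∼ (*-comm g′ f′))))

  -- The carrier stays and only the equality becomes coarser. A polynomial is therefore its own
  -- residue class and can be compared directly with a value computed in the quotient.
  quotientRing : CommutativeRing c a
  quotientRing = record
    { Carrier = Carrier
    ; _≈_     = _∼_
    ; _+_     = _+_
    ; _*_     = _*_
    ; -_      = -_
    ; 0#      = 0#
    ; 1#      = 1#
    ; isCommutativeRing = record
      { isRing = record
        { +-isAbelianGroup = record
          { isGroup = record
            { isMonoid = record
              { isSemigroup = record
                { isMagma = record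
                  { isEquivalence = record
                    { refl = ≈⇒∼ refl ; sym = ∼-sym ; trans = ∼-trans }
                  ; ∙-cong = ∼-+
                  }
                ; assoc = λ f g h → ≈⇒∼ (+-assoc f g h)
                }
              ; identity = (λ f → ≈⇒∼ (+-identityˡ f)) , λ f → ≈⇒∼ (+-identityʳ f)
              }
            ; inverse = (λ f → ≈⇒∼ (-‿inverseˡ f)) , λ f → ≈⇒∼ (-‿inverseʳ f)
            ; ⁻¹-cong = ∼-neg
            }
          ; comm = λ f g → ≈⇒∼ (+-comm f g)
          }
        ; *-cong     = ∼-*
        ; *-assoc    = λ f g h → ≈⇒∼ (*-assoc f g h)
        ; *-identity = (λ f → ≈⇒∼ (*-identityˡ f)) , λ f → ≈⇒∼ (*-identityʳ f)
        ; distrib    = (λ f g h → ≈⇒∼ (distribˡ f g h)) , λ f g h → ≈⇒∼ (distribʳ f g h)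
        }
      ; *-comm = λ f g → ≈⇒∼ (*-comm f g)
      }
    }

  ∼0⇒∈ : ∀ {f} → f ∼ 0# → I f
  ∼0⇒∈ (mk∼ p) = resp (trans (+-congˡ -0#≈0#) (+-identityʳ _)) p

module PolynomialIdeals {c ℓ} (R : CommutativeRing c ℓ) (n : ℕ) where

  open Polynomials R
  open PolynomialRing R
  open Evaluation R
  open Ideals n
  private
    module P = CommutativeRing (polyRing n)
    module K = CommutativeRing R
  open SumProperties P.semiring using (sum-cong-≋; *-distribˡ-sum)
  open CommutativeSemigroupProperties P.+-commutativeSemigroup using (interchange)
  open SetoidReasoning P.setoid

  IsIdealᴾ : ∀ {a} → Pred (Poly n) a → Set _
  IsIdealᴾ = IsIdeal (polyRing n)

  ∑-↑ : ∀ k {l} (f : Vector (Poly n) (k ℕ.+ l)) →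
        ∑ f P.≈ ∑ (λ i → f (i ↑ˡ l)) +ᴾ ∑ (λ i → f (k ↑ʳ i))
  ∑-↑ 0         f = P.refl
  ∑-↑ (ℕ.suc k) f = P.trans (P.+-congˡ {f zero} (∑-↑ k (f ∘ suc)))
    (P.sym (P.+-assoc (f zero) _ _))

  ⟨⟩-ideal : ∀ {a} (S : Pred (Poly n) a) → IsIdealᴾ ⟨ S ⟩
  ⟨⟩-ideal S = record
    { resp     = λ f≋f′ (k , h , g , g∈S , f≈) →
        k , h , g , g∈S ,
        coeff-≈ (P.trans (P.sym f≋f′) (mk≋ {g = ∑ (λ i → h i *ᴾ g i)} f≈))
    ; 0∈       = 0 , (λ ()) , (λ ()) , (λ ()) , λ _ → K.refl
    ; +-closed = λ {f} {f′} → closed {f} {f′}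
    ; *-closed = λ p {f} (k , h , g , g∈S , f≈) →
        k , (λ i → p *ᴾ h i) , g , g∈S , coeff-≈ (P.trans
          (P.*-congˡ {p} (mk≋ {f = f} {∑ (λ i → h i *ᴾ g i)} f≈)) (P.trans
          (*-distribˡ-sum p (λ i → h i *ᴾ g i))
          (sum-cong-≋ (λ i → P.sym (P.*-assoc p (h i) (g i))))))
    }
    where
    closed : ∀ {f f′} → ⟨ S ⟩ f → ⟨ S ⟩ f′ → ⟨ S ⟩ (f +ᴾ f′)
    closed {f} {f′} (k , h , g , g∈S , f≈) (l , h′ , g′ , g′∈S , f′≈) =
      k ℕ.+ l , h Vector.++ h′ , g Vector.++ g′ , gg∈S , coeff-≈ (begin
        f +ᴾ f′
          ≈⟨ P.+-cong (mk≋ {f = f} {∑ (λ i → h i *ᴾ g i)} f≈)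
               (mk≋ {f = f′} {∑ (λ i → h′ i *ᴾ g′ i)} f′≈) ⟩
        ∑ (λ i → h i *ᴾ g i) +ᴾ ∑ (λ i → h′ i *ᴾ g′ i)
          ≈⟨ P.+-cong
               (sum-cong-≋ (λ i → ≡⇒≋ (≡.cong₂ _*ᴾ_
                 (Vector.lookup-++ˡ h h′ i) (Vector.lookup-++ˡ g g′ i))))
               (sum-cong-≋ (λ i → ≡⇒≋ (≡.cong₂ _*ᴾ_
                 (Vector.lookup-++ʳ h h′ i) (Vector.lookup-++ʳ g g′ i)))) ⟨
        ∑ (λ i → hg (i ↑ˡ l)) +ᴾ ∑ (λ i → hg (k ↑ʳ i))
          ≈⟨ ∑-↑ k hg ⟨
        ∑ hg ∎)
      where
      hg : Vector (Poly n) (k ℕ.+ l)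
      hg i = (h Vector.++ h′) i *ᴾ (g Vector.++ g′) i
      gg∈S : ∀ i → S ((g Vector.++ g′) i)
      gg∈S i with Fin.splitAt k i
      ... | inj₁ j = g∈S j
      ... | inj₂ j = g′∈S j

  generator : ∀ {a} (S : Pred (Poly n) a) {f} → S f → ⟨ S ⟩ f
  generator S {f} f∈S = 1 , (λ _ → 1ᴾ) , (λ _ → f) , (λ _ → f∈S) , coeff-≈
    (P.sym (P.trans (P.+-identityʳ _) (P.*-identityˡ f)))

  +ᴵ-ideal : ∀ {a b} {I : Pred (Poly n) a} {J : Pred (Poly n) b} →
             IsIdealᴾ I → IsIdealᴾ J → IsIdealᴾ (I +ᴵ J)
  +ᴵ-ideal {I = I} {J} I-ideal J-ideal = record
    { resp     = λ f≋f′ (g , h , g∈I , h∈J , f≈) →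
        g , h , g∈I , h∈J , coeff-≈ (P.trans (P.sym f≋f′) (mk≋ {g = g +ᴾ h} f≈))
    ; 0∈       = 0ᴾ , 0ᴾ , I.0∈ , J.0∈ , λ _ → K.refl
    ; +-closed = λ {f} {f′} (g , h , g∈I , h∈J , f≈) (g′ , h′ , g′∈I , h′∈J , f′≈) →
        g +ᴾ g′ , h +ᴾ h′ , I.+-closed g∈I g′∈I , J.+-closed h∈J h′∈J , coeff-≈
          (P.trans (P.+-cong (mk≋ {f = f} {g +ᴾ h} f≈) (mk≋ {f = f′} {g′ +ᴾ h′} f′≈))
            (interchange g h g′ h′))
    ; *-closed = λ p {f} (g , h , g∈I , h∈J , f≈) →
        p *ᴾ g , p *ᴾ h , I.*-closed p g∈I , J.*-closed p h∈J , coeff-≈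
          (P.trans (P.*-congˡ {p} (mk≋ {f = f} {g +ᴾ h} f≈)) (P.distribˡ p g h))
    }
    where
    module I = IsIdeal I-ideal
    module J = IsIdeal J-ideal

  +ᴵ-left : ∀ {a b} {I : Pred (Poly n) a} {J : Pred (Poly n) b} →
            IsIdealᴾ J → ∀ {f} → I f → (I +ᴵ J) f
  +ᴵ-left J-ideal {f} f∈I = f , 0ᴾ , f∈I , IsIdeal.0∈ J-ideal ,
    coeff-≈ (P.sym (P.+-identityʳ f))

  +ᴵ-right : ∀ {a b} {I : Pred (Poly n) a} {J : Pred (Poly n) b} →
             IsIdealᴾ I → ∀ {f} → J f → (I +ᴵ J) f
  +ᴵ-right I-ideal {f} f∈J = 0ᴾ , f , IsIdeal.0∈ I-ideal , f∈J , λ _ → K.refl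

-- Finite fields

-- If `y` were missed, punching `y` out of the codomain would inject `Fin (suc n)` into `Fin n`.
injective⇒surjective : ∀ {n} (f : Fin n → Fin n) → Injective _≡_ _≡_ f →
                       ∀ y → ∃[ x ] f x ≡ y
injective⇒surjective {ℕ.suc n} f f-inj y with Fin.any? (λ x → f x Fin.≟ y)
... | yes hit  = hit
... | no  miss = contradiction
  (Fin.injective⇒≤ {f = λ x → Fin.punchOut (y≢f x)}
    (λ {x} {x′} eq → f-inj (Fin.punchOut-injective (y≢f x) (y≢f x′) eq)))
  ℕ.1+n≰n
  where
  y≢f : ∀ x → ¬ y ≡ f x
  y≢f x y≡fx = miss (x , ≡.sym y≡fx)

sum-injective : ∀ {c ℓ} (M : CommutativeMonoid c ℓ) → let open CommutativeMonoid M in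
                let open MonoidSum M in
                ∀ {n} (f : Fin n → Fin n) → Injective _≡_ _≡_ f →
                ∀ (t : Fin n → Carrier) → sum (t ∘ f) ≈ sum t
sum-injective M {n} f f-inj t = sym (sum-permute t
  (Perm.permutation f f⁻¹ (proj₂ ∘ f-surj) (λ x → f-inj (proj₂ (f-surj (f x))))))
  where
  open CommutativeMonoid M
  open MonoidSum M
  f-surj : ∀ y → ∃[ x ] f x ≡ y
  f-surj = injective⇒surjective f f-inj
  f⁻¹ : Fin n → Fin n
  f⁻¹ = proj₁ ∘ f-surj

-- Univariate polynomials as coefficient vectors, and their roots

module Univariate {c ℓ} (R : CommutativeRing c ℓ) where

  open CommutativeRing R hiding (zero)
  open ExpProperties commutativeSemiring using (_^_)
  open SumProperties semiring using
    (sum; sum-cong-≋; *-distribˡ-sum; sum-replicate-zero)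
  open RingProperties ring
  open CommutativeSemigroupProperties *-commutativeSemigroup using ()
    renaming (x∙yz≈y∙xz to *-swapˡ)
  open CommutativeSemigroupProperties +-commutativeSemigroup using ()
    renaming (interchange to +-interchange)
  open SetoidReasoning setoid

  poly : ∀ {n} → Vector Carrier n → Carrier → Carrier
  poly c x = sum (λ i → c i * x ^ toℕ i)

  poly-suc : ∀ {n} (c : Vector Carrier (ℕ.suc n)) x →
             poly c x ≈ c zero + x * poly (c ∘ suc) x
  poly-suc c x = +-cong (*-identityʳ _) (trans
    (sum-cong-≋ (λ i → *-swapˡ (c (suc i)) x (x ^ toℕ i)))
    (sym (*-distribˡ-sum x (λ i → c (suc i) * x ^ toℕ i))))

  poly-0 : ∀ {n} {c : Vector Carrier n} → (∀ i → c i ≈ 0#) → ∀ x → poly c x ≈ 0#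
  poly-0 {n} c≈0 x = trans (sum-cong-≋ (λ i → trans (*-congʳ (c≈0 i)) (zeroˡ _)))
    (sum-replicate-zero n)

  sum-minus : ∀ {n} (f g : Vector Carrier n) → sum (λ i → f i - g i) ≈ sum f - sum g
  sum-minus {0}       f g = sym (-‿inverseʳ 0#)
  sum-minus {ℕ.suc n} f g = begin
    (f zero - g zero) + sum (λ i → f (suc i) - g (suc i))
      ≈⟨ +-congˡ (sum-minus (f ∘ suc) (g ∘ suc)) ⟩
    (f zero - g zero) + (sum (f ∘ suc) - sum (g ∘ suc))
      ≈⟨ +-interchange _ _ _ _ ⟩
    (f zero + sum (f ∘ suc)) + (- g zero - sum (g ∘ suc))
      ≈⟨ +-congˡ (-‿+-comm _ _) ⟩
    sum f - sum g ∎

  poly-minus : ∀ {n} (c d : Vector Carrier n) x →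
           poly (λ i → c i - d i) x ≈ poly c x - poly d x
  poly-minus c d x = trans (sum-cong-≋ (λ i → [y-z]x≈yx-zx (x ^ toℕ i) (c i) (d i)))
    (sum-minus (λ i → c i * x ^ toℕ i) (λ i → d i * x ^ toℕ i))

  -- Synthetic division by x - a: the i-th coefficient of the quotient is the value at a of the
  -- polynomial with coefficients c_(i+1), c_(i+2), and so on.
  divide : ∀ {n} → Vector Carrier (ℕ.suc n) → Carrier → Vector Carrier n
  divide c a zero    = poly (c ∘ suc) a
  divide c a (suc i) = divide (c ∘ suc) a i

  divide-correct : ∀ {n} (c : Vector Carrier (ℕ.suc n)) a x →
                   poly c x ≈ poly c a + (x - a) * poly (divide c a) x
  divide-correct {0}       c a x = sym (trans (+-congˡ (zeroʳ _)) (+-identityʳ _))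
  divide-correct {ℕ.suc n} c a x = begin
    poly c x
      ≈⟨ poly-suc c x ⟩
    c zero + x * poly t x
      ≈⟨ +-congˡ (*-congˡ (divide-correct t a x)) ⟩
    c zero + x * (poly t a + (x - a) * poly d x)
      ≈⟨ +-congˡ (distribˡ x _ _) ⟩
    c zero + (x * poly t a + x * ((x - a) * poly d x))
      -- Writing the first `x` as `a + (x - a)` separates `a * poly t a`, which belongs to the
      -- remainder `poly c a`, from `(x - a) * poly t a`, which is the contribution of the
      -- quotient's constant coefficient.
      ≈⟨ +-congˡ (+-cong (*-congʳ (sym a+[x-a]≈x)) (*-swapˡ x (x - a) _)) ⟩
    c zero + ((a + (x - a)) * poly t a + (x - a) * (x * poly d x))
      ≈⟨ +-congˡ (+-congʳ (distribʳ _ a (x - a))) ⟩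
    c zero + ((a * poly t a + (x - a) * poly t a) + (x - a) * (x * poly d x))
      ≈⟨ +-congˡ (+-assoc _ _ _) ⟩
    c zero + (a * poly t a + ((x - a) * poly t a + (x - a) * (x * poly d x)))
      ≈⟨ +-assoc _ _ _ ⟨
    (c zero + a * poly t a) + ((x - a) * poly t a + (x - a) * (x * poly d x))
      ≈⟨ +-cong (poly-suc c a) (distribˡ (x - a) _ _) ⟨
    poly c a + (x - a) * (poly t a + x * poly d x)
      ≈⟨ +-congˡ (*-congˡ (poly-suc (divide c a) x)) ⟨
    poly c a + (x - a) * poly (divide c a) x ∎
    where
    t = c ∘ suc
    d = divide t a
    a+[x-a]≈x : a + (x - a) ≈ x
    a+[x-a]≈x = trans (+-comm a _) (trans (+-assoc x _ _)
      (trans (+-congˡ (-‿inverseˡ a)) (+-identityʳ x)))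

  -- The last coefficient of the quotient is the leading one of `c`. Descending from there, each
  -- quotient coefficient is the next coefficient of `c` plus a times a polynomial in the higher
  -- ones, which are already zero.
  divide-zero : ∀ {n} (c : Vector Carrier (ℕ.suc n)) a → (∀ i → divide c a i ≈ 0#) →
                ∀ i → c (suc i) ≈ 0#
  divide-zero {ℕ.suc n} c a d≈0 = λ { zero → head≈0 ; (suc i) → tail≈0 i }
    where
    tail≈0 : ∀ i → c (suc (suc i)) ≈ 0#
    tail≈0 = divide-zero (c ∘ suc) a (d≈0 ∘ suc)
    head≈0 : c (suc zero) ≈ 0#
    head≈0 = begin
      c (suc zero)                                ≈⟨ +-identityʳ _ ⟨
      c (suc zero) + 0#
        ≈⟨ +-congˡ (trans (*-congˡ (poly-0 tail≈0 a)) (zeroʳ a)) ⟨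
      c (suc zero) + a * poly (c ∘ suc ∘ suc) a   ≈⟨ poly-suc (c ∘ suc) a ⟨
      poly (c ∘ suc) a                            ≈⟨ d≈0 zero ⟩
      0#                                          ∎

  -- There are as many distinct roots as coefficients. Dividing out x - p₀ lowers both numbers by
  -- one: every other p_j is a root of the quotient, because the nonzero factor p_j - p₀ cancels.
  roots⇒zero : (∀ {x y} → ¬ x ≈ 0# → x * y ≈ 0# → y ≈ 0#) →
               ∀ {n} (c p : Vector Carrier n) → (∀ {i j} → p i ≈ p j → i ≡ j) →
               (∀ j → poly c (p j) ≈ 0#) → ∀ i → c i ≈ 0#
  roots⇒zero cancel {ℕ.suc n} c p p-inj roots = λ { zero → c₀≈0 ; (suc i) → tail≈0 i }
    where
    a = p zero
    p≉a : ∀ j → ¬ p (suc j) - a ≈ 0#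
    p≉a j eq with () ← p-inj (x∙y⁻¹≈ε⇒x≈y _ _ eq)
    quotient-root : ∀ j → poly (divide c a) (p (suc j)) ≈ 0#
    quotient-root j = cancel (p≉a j) (begin
      (p (suc j) - a) * poly (divide c a) (p (suc j))
        ≈⟨ +-identityˡ _ ⟨
      0# + (p (suc j) - a) * poly (divide c a) (p (suc j))
        ≈⟨ +-congʳ (roots zero) ⟨
      poly c a + (p (suc j) - a) * poly (divide c a) (p (suc j))
        ≈⟨ divide-correct c a (p (suc j)) ⟨
      poly c (p (suc j))
        ≈⟨ roots (suc j) ⟩
      0# ∎)
    tail≈0 : ∀ i → c (suc i) ≈ 0#
    tail≈0 = divide-zero c a
      (roots⇒zero cancel (divide c a) (p ∘ suc) (Fin.suc-injective ∘ p-inj) quotient-root)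
    c₀≈0 : c zero ≈ 0#
    c₀≈0 = begin
      c zero                       ≈⟨ +-identityʳ _ ⟨
      c zero + 0#                  ≈⟨ +-congˡ (trans (*-congˡ (poly-0 tail≈0 a)) (zeroʳ a)) ⟨
      c zero + a * poly (c ∘ suc) a ≈⟨ poly-suc c a ⟨
      poly c a                     ≈⟨ roots zero ⟩
      0#                           ∎

-- Fermat's theorem and power sums in a field with q = r + 2 elements

module FiniteFieldProperties {c ℓ r} (K : FiniteField c ℓ (ℕ.suc (ℕ.suc r))) where

  open FiniteField K hiding (zero)
  open ExpProperties commutativeSemiring using (_^_; ^-congˡ; ^-distrib-*)
  open SumProperties semiring using
    (sum; sum-cong-≋; sum-remove; ∑-distrib-+; *-distribˡ-sum)
  open MonoidSum *-commutativeMonoid using () renaming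
    (sum to product; sum-cong-≋ to product-cong; sum-remove to product-remove;
     ∑-distrib-+ to product-distrib; sum-replicate to product-replicate)
  open RingProperties ring
  open MonoidHomomorphism +-commutativeMonoid using (sum-single)
  open Univariate commutativeRing
  open SetoidReasoning setoid

  q : ℕ
  q = ℕ.suc (ℕ.suc r)

  el : Fin q → Carrier
  el = Bijection.to cardinality

  el-injective : ∀ {i j} → el i ≈ el j → i ≡ j
  el-injective = Bijection.injective cardinality

  idx : Carrier → Fin q
  idx x = proj₁ (Bijection.surjective cardinality x)

  el-idx : ∀ x → el (idx x) ≈ x
  el-idx x = proj₂ (Bijection.surjective cardinality x) ≡.refl

  infix 4 _≈?_
  _≈?_ : Decidable _≈_
  x ≈? y with idx x Fin.≟ idx y
  ... | yes i≡j = yes (trans (sym (el-idx x)) (trans (reflexive (≡.cong el i≡j)) (el-idx y)))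
  ... | no  i≢j = no λ x≈y →
    i≢j (el-injective (trans (el-idx x) (trans x≈y (sym (el-idx y)))))

  *-cancel-0 : ∀ {x y} → ¬ x ≈ 0# → x * y ≈ 0# → y ≈ 0#
  *-cancel-0 {x} {y} x≉0 xy≈0 with x⁻¹ , xx⁻¹≈1 ← inverse x x≉0 = begin
    y               ≈⟨ *-identityˡ y ⟨
    1# * y          ≈⟨ *-congʳ (trans (*-comm _ _) xx⁻¹≈1) ⟨
    (x⁻¹ * x) * y   ≈⟨ *-assoc _ _ _ ⟩
    x⁻¹ * (x * y)   ≈⟨ *-congˡ xy≈0 ⟩
    x⁻¹ * 0#        ≈⟨ zeroʳ _ ⟩
    0#              ∎

  *-cancelˡ : ∀ {x y z} → ¬ x ≈ 0# → x * y ≈ x * z → y ≈ z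
  *-cancelˡ {x} {y} {z} x≉0 xy≈xz = x∙y⁻¹≈ε⇒x≈y y z (*-cancel-0 x≉0
    (trans (x[y-z]≈xy-xz x y z) (x≈y⇒x∙y⁻¹≈ε xy≈xz)))

  ^≈0⇒≈0 : ∀ x k → x ^ k ≈ 0# → x ≈ 0#
  ^≈0⇒≈0 x 0         1≈0 = contradiction 1≈0 1≉0
  ^≈0⇒≈0 x (ℕ.suc k) x^k≈0 with x ≈? 0#
  ... | yes x≈0 = x≈0
  ... | no  x≉0 = ^≈0⇒≈0 x k (*-cancel-0 x≉0 x^k≈0)

  0^suc : ∀ {x} k → x ≈ 0# → x ^ ℕ.suc k ≈ 0#
  0^suc k x≈0 = trans (*-congʳ x≈0) (zeroˡ _)

  product≈0 : ∀ {n} (f : Vector Carrier n) → product f ≈ 0# → ∃[ i ] f i ≈ 0#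
  product≈0 {0}       f 1≈0 = contradiction 1≈0 1≉0
  product≈0 {ℕ.suc n} f ∏≈0 with f zero ≈? 0#
  ... | yes f₀≈0 = zero , f₀≈0
  ... | no  f₀≉0 with i , fᵢ≈0 ← product≈0 (f ∘ suc) (*-cancel-0 f₀≉0 ∏≈0) = suc i , fᵢ≈0

  factor≈0 : ∀ {n} (f : Vector Carrier n) i → f i ≈ 0# → product f ≈ 0#
  factor≈0 f zero    fᵢ≈0 = trans (*-congʳ fᵢ≈0) (zeroˡ _)
  factor≈0 f (suc i) fᵢ≈0 = trans (*-congˡ (factor≈0 (f ∘ suc) i fᵢ≈0)) (zeroʳ _)

  -- The monoid is arbitrary because multiplication by a constant is reindexed in a product for
  -- `fermat`, and both translations and multiplications in sums for the power sums.
  reindex : ∀ {m n} (M : CommutativeMonoid m n) → let module M = CommutativeMonoid M in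
            let open MonoidSum M using () renaming (sum to sumᴹ) in
            (ψ : Carrier → M.Carrier) → (∀ {x y} → x ≈ y → ψ x M.≈ ψ y) →
            (φ : Carrier → Carrier) → Injective _≈_ _≈_ φ →
            sumᴹ (λ i → ψ (φ (el i))) M.≈ sumᴹ (λ i → ψ (el i))
  reindex M ψ ψ-cong φ φ-inj = M.trans
    (MonoidSum.sum-cong-≋ M (λ i → ψ-cong (sym (el-idx (φ (el i))))))
    (sum-injective M (λ i → idx (φ (el i)))
      (λ {i} {j} eq → el-injective (φ-inj (trans (sym (el-idx _))
        (trans (reflexive (≡.cong el eq)) (el-idx _)))))
      (λ i → ψ (el i)))
    where module M = CommutativeMonoid M

  -- With `d = 1#` the element zero contributes a neutral factor, so a product over the nonzero
  -- elements becomes one over all of `Fin q`, to which `reindex` applies.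
  nonzeroOr : Carrier → Carrier → Carrier → Carrier
  nonzeroOr d y x = if does (x ≈? 0#) then d else y

  nonzeroOr-0 : ∀ d y {x} → x ≈ 0# → nonzeroOr d y x ≡ d
  nonzeroOr-0 d y {x} x≈0 = ≡.cong (if_then d else y) (dec-true (x ≈? 0#) x≈0)

  nonzeroOr-≉0 : ∀ d y {x} → ¬ x ≈ 0# → nonzeroOr d y x ≡ y
  nonzeroOr-≉0 d y {x} x≉0 = ≡.cong (if_then d else y) (dec-false (x ≈? 0#) x≉0)

  0≡el-only : ∀ j → ¬ el (Fin.punchIn (idx 0#) j) ≈ 0#
  0≡el-only j eq = Fin.punchInᵢ≢i (idx 0#) j (el-injective (trans eq (sym (el-idx 0#))))

  -- Multiplication by a permutes the nonzero elements, so their product P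
  -- satisfies P = a^(q-1) P.
  fermat : ∀ {a} → ¬ a ≈ 0# → a ^ ℕ.suc r ≈ 1#
  fermat {a} a≉0 = begin
    a ^ ℕ.suc r                              ≈⟨ product-replicate (ℕ.suc r) ⟨
    product {ℕ.suc r} (λ _ → a)
      ≈⟨ product-cong (λ j → reflexive (nonzeroOr-≉0 1# a (0≡el-only j))) ⟨
    product (λ j → k (el (Fin.punchIn (idx 0#) j)))
      ≈⟨ *-identityˡ _ ⟨
    1# * product (λ j → k (el (Fin.punchIn (idx 0#) j)))
      ≈⟨ *-congʳ (reflexive (nonzeroOr-0 1# a (el-idx 0#))) ⟨
    k (el (idx 0#)) * product (λ j → k (el (Fin.punchIn (idx 0#) j)))
      ≈⟨ product-remove {i = idx 0#} (k ∘ el) ⟨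
    product (k ∘ el)
      ≈⟨ *-cancelˡ P≉0 (trans (*-comm _ _) (trans kP≈P (sym (*-identityʳ P)))) ⟩
    1# ∎
    where
    k nz : Carrier → Carrier
    k    = nonzeroOr 1# a
    nz x = nonzeroOr 1# x x
    P : Carrier
    P = product (nz ∘ el)
    nz≉0 : ∀ x → ¬ nz x ≈ 0#
    nz≉0 x with x ≈? 0#
    ... | yes _   = 1≉0
    ... | no  x≉0 = x≉0
    nz-cong : ∀ {x y} → x ≈ y → nz x ≈ nz y
    nz-cong {x} {y} x≈y with x ≈? 0# | y ≈? 0#
    ... | yes _   | yes _   = refl
    ... | yes x≈0 | no  y≉0 = contradiction (trans (sym x≈y) x≈0) y≉0
    ... | no  x≉0 | yes y≈0 = contradiction (trans x≈y y≈0) x≉0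
    ... | no  _   | no  _   = x≈y
    P≉0 : ¬ P ≈ 0#
    P≉0 P≈0 with i , eq ← product≈0 (nz ∘ el) P≈0 = nz≉0 (el i) eq
    nz-* : ∀ x → k x * nz x ≈ nz (a * x)
    nz-* x with x ≈? 0# | a * x ≈? 0#
    ... | yes _   | yes _    = *-identityˡ 1#
    ... | yes x≈0 | no  ax≉0 = contradiction (trans (*-congˡ x≈0) (zeroʳ a)) ax≉0
    ... | no  x≉0 | yes ax≈0 = contradiction (*-cancel-0 a≉0 ax≈0) x≉0
    ... | no  _   | no  _    = refl
    kP≈P : product (k ∘ el) * P ≈ P
    kP≈P = trans (sym (product-distrib (k ∘ el) (nz ∘ el)))
      (trans (product-cong (λ i → nz-* (el i)))
        (reindex *-commutativeMonoid nz nz-cong (a *_) (*-cancelˡ a≉0)))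

  frobenius : ∀ a → a ^ q ≈ a
  frobenius a with a ≈? 0#
  ... | yes a≈0 = trans (0^suc (ℕ.suc r) a≈0) (sym a≈0)
  ... | no  a≉0 = trans (*-congˡ (fermat a≉0)) (*-identityʳ a)

  poly-injective : ∀ (c : Vector Carrier q) → (∀ a → poly c a ≈ 0#) → ∀ i → c i ≈ 0#
  poly-injective c c≈0 = roots⇒zero *-cancel-0 c el el-injective (λ j → c≈0 (el j))

  powerSum : ℕ → Carrier
  powerSum k = sum (λ i → el i ^ k)

  -- Translation by 1 permutes K, so Σ a = Σ (a + 1) = Σ a + Σ 1, which leaves Σ 1 = 0.
  powerSum-0 : powerSum 0 ≈ 0#
  powerSum-0 = +-identityʳ-unique (sum el) (powerSum 0) (begin
    sum el + powerSum 0         ≈⟨ ∑-distrib-+ el (λ _ → 1#) ⟨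
    sum (λ i → el i + 1#)
      ≈⟨ reindex +-commutativeMonoid (λ x → x) (λ x≈y → x≈y) (_+ 1#) (+-cancelʳ 1# _ _) ⟩
    sum el                      ∎)

  δ′ : ℕ → Fin q → Carrier
  δ′ k i = if does (k ℕ.≟ toℕ i) then 1# else 0#

  poly-δ : ∀ (k : Fin q) x → poly (δ′ (toℕ k)) x ≈ x ^ toℕ k
  poly-δ k x = begin
    poly (δ′ (toℕ k)) x
      ≈⟨ sum-single k _ (λ j k≢j → trans (*-congʳ (reflexive (≡.cong (if_then 1# else 0#)
           (dec-false (toℕ k ℕ.≟ toℕ j) (k≢j ∘ Fin.toℕ-injective))))) (zeroˡ (x ^ toℕ j))) ⟩
    δ′ (toℕ k) k * x ^ toℕ k
      ≡⟨ ≡.cong (λ b → (if b then 1# else 0#) * x ^ toℕ k)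
           (dec-true (toℕ k ℕ.≟ toℕ k) ≡.refl) ⟩
    1# * x ^ toℕ k
      ≈⟨ *-identityˡ _ ⟩
    x ^ toℕ k ∎

  -- x^(k+1) - x has degree less than q, so it does not vanish on K.
  nontrivialPower : ∀ k → 1 ℕ.≤ k → k ℕ.≤ r → ∃[ g ] ¬ g ^ ℕ.suc k ≈ g
  nontrivialPower k 1≤k k≤r =
    let i , eq = Fin.¬∀⟶∃¬ q _ (λ i → el i ^ ℕ.suc k ≈? el i) ¬all in el i , eq
    where
    k+1 one : Fin q
    k+1 = suc (Fin.fromℕ< (s≤s k≤r))
    one = suc zero
    toℕ-k+1 : toℕ k+1 ≡ ℕ.suc k
    toℕ-k+1 = ≡.cong ℕ.suc (Fin.toℕ-fromℕ< (s≤s k≤r))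
    d : Fin q → Carrier
    d i = δ′ (toℕ k+1) i - δ′ 1 i
    ¬all : ¬ (∀ i → el i ^ ℕ.suc k ≈ el i)
    ¬all all = 1≉0 (begin
      1#                ≈⟨ trans (+-congˡ -0#≈0#) (+-identityʳ 1#) ⟨
      1# - 0#           ≡⟨ ≡.cong₂ (λ b b′ → (if b then 1# else 0#) - (if b′ then 1# else 0#))
                             (dec-true (toℕ k+1 ℕ.≟ toℕ k+1) ≡.refl)
                             (dec-false (1 ℕ.≟ toℕ k+1) λ eq → ℕ.<⇒≢ (s≤s 1≤k)
                               (≡.trans eq toℕ-k+1)) ⟨
      d k+1             ≈⟨ poly-injective d vanish k+1 ⟩
      0#                ∎)
      where
      vanish : ∀ a → poly d a ≈ 0#
      vanish a = begin
        poly d a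
          ≈⟨ poly-minus (δ′ (toℕ k+1)) (δ′ 1) a ⟩
        poly (δ′ (toℕ k+1)) a - poly (δ′ 1) a
          ≈⟨ +-cong (poly-δ k+1 a) (-‿cong (poly-δ one a)) ⟩
        a ^ toℕ k+1 - a ^ 1
          ≈⟨ +-cong (reflexive (≡.cong (a ^_) toℕ-k+1)) (-‿cong (*-identityʳ a)) ⟩
        a ^ ℕ.suc k - a
          ≈⟨ x≈y⇒x∙y⁻¹≈ε (trans (^-congˡ (ℕ.suc k) (sym (el-idx a)))
               (trans (all (idx a)) (el-idx a))) ⟩
        0# ∎

  powerSum-scale : ∀ g k → ¬ g ≈ 0# → g ^ k * powerSum k ≈ powerSum k
  powerSum-scale g k g≉0 = begin
    g ^ k * powerSum k               ≈⟨ *-distribˡ-sum (g ^ k) (λ i → el i ^ k) ⟩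
    sum (λ i → g ^ k * el i ^ k)
      ≈⟨ sum-cong-≋ {q} {λ i → g ^ k * el i ^ k} {λ i → (g * el i) ^ k}
           (λ i → sym (^-distrib-* g (el i) k)) ⟩
    sum (λ i → (g * el i) ^ k)
      ≈⟨ reindex +-commutativeMonoid (_^ k) (^-congˡ k) (g *_) (*-cancelˡ g≉0) ⟩
    powerSum k                       ∎

  fixed⇒0 : ∀ x y → ¬ x ≈ 1# → x * y ≈ y → y ≈ 0#
  fixed⇒0 x y x≉1 xy≈y = *-cancel-0 {x - 1#} (x≉1 ∘ x∙y⁻¹≈ε⇒x≈y x 1#) (begin
    (x - 1#) * y     ≈⟨ [y-z]x≈yx-zx y x 1# ⟩
    x * y - 1# * y   ≈⟨ +-cong xy≈y (-‿cong (*-identityˡ y)) ⟩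
    y - y            ≈⟨ -‿inverseʳ y ⟩
    0#               ∎)

  -- For positive k, the inequality g^(k+1) ≠ g says at once that g ≠ 0 and that g^k ≠ 1. Scaling by
  -- such a g permutes the summands but multiplies the sum by g^k, so the sum is zero.
  powerSum-< : ∀ k → k ℕ.≤ r → powerSum k ≈ 0#
  powerSum-< 0             _   = powerSum-0
  powerSum-< k@(ℕ.suc _)  k≤r = fixed⇒0 (g ^ k) (powerSum k)
    (λ g^k≈1 → g^[k+1]≉g (trans (*-congˡ g^k≈1) (*-identityʳ g)))
    (powerSum-scale g k (λ g≈0 → g^[k+1]≉g (trans (0^suc k g≈0) (sym g≈0))))
    where
    g : Carrier
    g = proj₁ (nontrivialPower k (s≤s z≤n) k≤r)
    g^[k+1]≉g : ¬ g ^ ℕ.suc k ≈ g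
    g^[k+1]≉g = proj₂ (nontrivialPower k (s≤s z≤n) k≤r)

  -- The summand at zero is 0 and all others are 1 by Fermat. Adding 1 therefore yields a sum of q
  -- ones, which is `powerSum 0`; the power sum itself equals -1.
  powerSum-q-1 : ¬ powerSum (ℕ.suc r) ≈ 0#
  powerSum-q-1 eq = 1≉0 (begin
    1#                                   ≈⟨ +-identityʳ 1# ⟨
    1# + 0#                              ≈⟨ +-congˡ eq ⟨
    1# + powerSum (ℕ.suc r)
      ≈⟨ +-congˡ (sum-remove {i = idx 0#} (λ i → el i ^ ℕ.suc r)) ⟩
    1# + (el (idx 0#) ^ ℕ.suc r + sum (λ j → el (Fin.punchIn (idx 0#) j) ^ ℕ.suc r))
      ≈⟨ +-congˡ (+-congʳ (0^suc r (el-idx 0#))) ⟩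
    1# + (0# + sum (λ j → el (Fin.punchIn (idx 0#) j) ^ ℕ.suc r))
      ≈⟨ +-congˡ (trans (+-identityˡ _) (sum-cong-≋ (λ j → fermat (0≡el-only j)))) ⟩
    powerSum 0                           ≈⟨ powerSum-0 ⟩
    0#                                   ∎)

-- Polynomials vanishing on an algebraic set

-- The exponent after q - 1 wraps to 1 and not to 0: x^q = x holds at x = 0, while x^(q-1) = 1 does
-- not.
nextExponent : ∀ {r} → Fin (ℕ.suc (ℕ.suc r)) → Fin (ℕ.suc (ℕ.suc r))
nextExponent {r} i with ℕ.suc (toℕ i) ℕ.<? ℕ.suc (ℕ.suc r)
... | yes i+1<q = Fin.fromℕ< i+1<q
... | no  _     = suc zero

-- The exponent below q = r + 2 to which the equation x^q = x reduces x^k.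
reduce : ∀ r → ℕ → Fin (ℕ.suc (ℕ.suc r))
reduce r 0         = zero
reduce r (ℕ.suc k) = nextExponent (reduce r k)

module ReducedPowers {c ℓ} (A : CommutativeRing c ℓ) (r : ℕ) where

  open CommutativeRing A hiding (zero)
  open ExpProperties commutativeSemiring using (_^_)

  ^-next : ∀ {x} → x ^ ℕ.suc (ℕ.suc r) ≈ x → ∀ (i : Fin (ℕ.suc (ℕ.suc r))) →
           x ^ ℕ.suc (toℕ i) ≈ x ^ toℕ (nextExponent i)
  ^-next {x} x^q≈x i with ℕ.suc (toℕ i) ℕ.<? ℕ.suc (ℕ.suc r)
  ... | yes i+1<q = reflexive (≡.cong (x ^_) (≡.sym (Fin.toℕ-fromℕ< i+1<q)))
  ... | no  i+1≮q = trans (reflexive (≡.cong (x ^_)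
      (ℕ.≤-antisym (Fin.toℕ<n i) (ℕ.≮⇒≥ i+1≮q))))
    (trans x^q≈x (sym (*-identityʳ x)))

  ^-reduce : ∀ {x} → x ^ ℕ.suc (ℕ.suc r) ≈ x → ∀ k → x ^ k ≈ x ^ toℕ (reduce r k)
  ^-reduce x^q≈x 0         = refl
  ^-reduce x^q≈x (ℕ.suc k) = trans (*-congˡ (^-reduce x^q≈x k)) (^-next x^q≈x (reduce r k))

module Slices {c ℓ} (R : CommutativeRing c ℓ) (r : ℕ) where

  open CommutativeRing R using (0#)
  open Polynomials R using (Poly)

  -- f = Σ_i x₀^i · slice i f modulo x₀^q = x₀.
  slice : ∀ {n} → Fin (ℕ.suc (ℕ.suc r)) → Poly (ℕ.suc n) → Poly n
  slice i []                = []
  slice i ((a , k ∷ e) ∷ f) =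
    ((if does (reduce r k Fin.≟ i) then a else 0#) , e) ∷ slice i f

module Slicing {c ℓ a ℓ′} (R : CommutativeRing c ℓ) (A : CommutativeRing a ℓ′)
               (ι : CommutativeRing.Carrier R → CommutativeRing.Carrier A)
               (ι-hom : MonoidMorphisms.IsMonoidHomomorphism
                  (CommutativeRing.+-rawMonoid R) (CommutativeRing.+-rawMonoid A) ι)
               (r : ℕ) where

  private module R = CommutativeRing R
  open CommutativeRing A hiding (zero)
  open Polynomials R using (Poly)
  open ReducedPowers A r
  open Slices R r
  open MonoidMorphisms.IsMonoidHomomorphism ι-hom renaming (ε-homo to ι-0)
  open RawSemiringDefs (Semiring.rawSemiring semiring) using (product)
  open ExpProperties commutativeSemiring using (_^_)
  open SumProperties semiring using (sum; sum-cong-≋; ∑-distrib-+; sum-replicate-zero)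
  open CommutativeSemigroupProperties *-commutativeSemigroup using ()
    renaming (x∙yz≈y∙xz to *-swapˡ)
  open MonoidHomomorphism +-commutativeMonoid using (sum-single)
  open SetoidReasoning setoid

  private
    q : ℕ
    q = ℕ.suc (ℕ.suc r)

  -- For A = K and ι the identity this is `eval`. For A the quotient ring, ι = `con` and the
  -- variables as the point, it gives back `f`. Additivity is the structure asked of ι because
  -- coefficients are only added or replaced by zero.
  evalᴬ : ∀ {n} → Poly n → Vector Carrier n → Carrier
  evalᴬ []            s = 0#
  evalᴬ ((a , e) ∷ f) s = ι a * product (λ i → s i ^ Vec.lookup e i) + evalᴬ f s

  evalᴬ-slice : ∀ {n} (f : Poly (ℕ.suc n)) (s : Vector Carrier (ℕ.suc n)) →
                s zero ^ q ≈ s zero →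
                evalᴬ f s ≈ sum (λ i → s zero ^ toℕ i * evalᴬ (slice i f) (s ∘ suc))
  evalᴬ-slice []                s s₀^q≈s₀ = sym (trans
    (sum-cong-≋ {q} {λ i → s zero ^ toℕ i * 0#} (λ i → zeroʳ _))
    (sum-replicate-zero q))
  evalᴬ-slice ((a , k ∷ e) ∷ f) s s₀^q≈s₀ = begin
    ι a * (x ^ k * M) + evalᴬ f s
      ≈⟨ +-cong (*-congˡ (*-congʳ (^-reduce s₀^q≈s₀ k))) (evalᴬ-slice f s s₀^q≈s₀) ⟩
    ι a * (x ^ toℕ j * M) + sum rest
      ≈⟨ +-congʳ (*-swapˡ (ι a) (x ^ toℕ j) M) ⟩
    x ^ toℕ j * (ι a * M) + sum rest
      ≡⟨ ≡.cong (λ b → x ^ toℕ j * (ι b * M) + sum rest) (selected a) ⟨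
    first j + sum rest
      -- `slice` keeps the term in every slice, with coefficient zero in all but slice `j`, so
      -- `first` has a single summand that counts.
      ≈⟨ +-congʳ (sum-single j first λ i j≢i → trans (*-congˡ (trans (*-congʳ
           (trans (reflexive (≡.cong ι (rejected a j≢i))) ι-0)) (zeroˡ M))) (zeroʳ _)) ⟨
    sum first + sum rest
      ≈⟨ ∑-distrib-+ first rest ⟨
    sum (λ i → first i + rest i)
      ≈⟨ sum-cong-≋ {q} {λ i → first i + rest i} (λ i → sym (distribˡ (x ^ toℕ i) _ _)) ⟩
    sum (λ i → x ^ toℕ i * evalᴬ (slice i ((a , k ∷ e) ∷ f)) (s ∘ suc)) ∎
    where
    x M : Carrier
    x = s zero
    M = product (λ i → s (suc i) ^ Vec.lookup e i)
    j : Fin q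
    j = reduce r k
    selected : ∀ a → (if does (j Fin.≟ j) then a else R.0#) ≡ a
    selected a = ≡.cong (if_then a else R.0#) (dec-true (j Fin.≟ j) ≡.refl)
    rejected : ∀ a {i} → ¬ j ≡ i → (if does (j Fin.≟ i) then a else R.0#) ≡ R.0#
    rejected a {i} j≢i = ≡.cong (if_then a else R.0#) (dec-false (j Fin.≟ i) j≢i)
    first rest : Fin q → Carrier
    first i = x ^ toℕ i * (ι (if does (j Fin.≟ i) then a else R.0#) * M)
    rest i = x ^ toℕ i * evalᴬ (slice i f) (s ∘ suc)

module VanishingPolynomials {c ℓ r} (K : FiniteField c ℓ (ℕ.suc (ℕ.suc r))) where

  open FiniteField K hiding (zero)
  open Polynomials commutativeRing
  open PolynomialRing commutativeRing
  open Evaluation commutativeRing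
  open FiniteFieldProperties K
  open Univariate commutativeRing
  open Slices commutativeRing r
  open ExpProperties commutativeSemiring using (_^_)
  open SumProperties semiring using (sum-cong-≋)

  private
    module S = Slicing commutativeRing commutativeRing (λ a → a)
      (Identity.isMonoidHomomorphism +-rawMonoid refl) r

    eval≡ : ∀ {n} (f : Poly n) s → eval f s ≡ S.evalᴬ f s
    eval≡ []            s = ≡.refl
    eval≡ ((a , e) ∷ f) s = ≡.cong (a * point s e +_) (eval≡ f s)

  eval-slice : ∀ {n} (f : Poly (ℕ.suc n)) a s →
               eval f (a Vector.∷ s) ≈ poly (λ i → eval (slice i f) s) a
  eval-slice f a s = trans (reflexive (eval≡ f (a Vector.∷ s)))
    (trans (S.evalᴬ-slice f (a Vector.∷ s) (frobenius a))
      (sum-cong-≋ {q} {λ i → a ^ toℕ i * S.evalᴬ (slice i f) s} (λ i →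
        trans (*-comm _ _) (*-congʳ (reflexive (≡.sym (eval≡ (slice i f) s)))))))

  -- For fixed `s`, the slices evaluated at `s` are the q coefficients of a univariate polynomial in
  -- the first coordinate that is zero on all of K.
  slice-vanish : ∀ {n} (f : Poly (ℕ.suc n)) → (∀ s → eval f s ≈ 0#) →
                 ∀ i s → eval (slice i f) s ≈ 0#
  slice-vanish f f≈0 i s = poly-injective (λ i → eval (slice i f) s)
    (λ a → trans (sym (eval-slice f a s)) (f≈0 (a Vector.∷ s))) i

  module _ {a ℓ′} (A : CommutativeRing a ℓ′)
           (ι : Carrier → CommutativeRing.Carrier A)
           (ι-hom : MonoidMorphisms.IsMonoidHomomorphism
             +-rawMonoid (CommutativeRing.+-rawMonoid A) ι) where
    private module A = CommutativeRing A
    open MonoidMorphisms.IsMonoidHomomorphism ι-hom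
      renaming (homo to ι-+; ε-homo to ι-0; ⟦⟧-cong to ι-cong)
    open ExpProperties A.commutativeSemiring using () renaming (_^_ to _^ᴬ_)
    open SumProperties A.semiring using ()
      renaming (sum-cong-≋ to sum-congᴬ; sum-replicate-zero to sum-0ᴬ)
    open Slicing commutativeRing A ι ι-hom r

    evalᴬ-const : ∀ (f : Poly 0) s x → evalᴬ f x A.≈ ι (eval f s)
    evalᴬ-const []             s x = A.sym ι-0
    evalᴬ-const ((a , []) ∷ f) s x = A.trans
      (A.+-cong (A.trans (A.*-identityʳ (ι a)) (ι-cong (sym (*-identityʳ a))))
        (evalᴬ-const f s x))
      (A.sym (ι-+ (a * 1#) (eval f s)))

    -- The hypothesis concerns points over K, the conclusion points over A. Vanishing passes down to
    -- the slices over K by `slice-vanish` and comes back up over A by `evalᴬ-slice`; with no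
    -- variables left, `f` is a constant equal to zero in K.
    evalᴬ-vanish : ∀ {n} (f : Poly n) → (∀ s → eval f s ≈ 0#) →
                   ∀ x → (∀ v → x v ^ᴬ q A.≈ x v) → evalᴬ f x A.≈ A.0#
    evalᴬ-vanish {0}       f f≈0 x x^q≈x =
      A.trans (evalᴬ-const f (λ ()) x) (A.trans (ι-cong (f≈0 (λ ()))) ι-0)
    evalᴬ-vanish {ℕ.suc n} f f≈0 x x^q≈x = A.trans (evalᴬ-slice f x (x^q≈x zero))
      (A.trans
        (sum-congᴬ {q} {λ i → x zero ^ᴬ toℕ i A.* evalᴬ (slice i f) (x ∘ suc)} (λ i →
          A.trans (A.*-congˡ (evalᴬ-vanish (slice i f) (slice-vanish f f≈0 i)
            (x ∘ suc) (x^q≈x ∘ suc))) (A.zeroʳ _)))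
        (sum-0ᴬ q))

-- The Nullstellensatz over a finite field

module Nullstellensatz {c ℓ r} (K : FiniteField c ℓ (ℕ.suc (ℕ.suc r))) (n : ℕ) where

  open FiniteField K hiding (zero)
  open Polynomials commutativeRing
  open PolynomialRing commutativeRing
  open Evaluation commutativeRing
  open PolynomialIdeals commutativeRing n
  open FiniteFieldProperties K
  open VanishingPolynomials K
  open Ideals n
  private module P = CommutativeRing (polyRing n)
  open ExpProperties commutativeSemiring using (_^_)

  Vanish : List (Poly n) → Vector Carrier n → Set _
  Vanish gs s = All (λ g → eval g s ≈ 0#) gs

  module _ {a} {I : Pred (Poly n) a} (I-ideal : IsIdealᴾ I) where

    open IsIdeal I-ideal
    private
      module Q = Quotient (polyRing n) I-ideal
      module A = CommutativeRing Q.quotientRing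
    open ExpProperties A.commutativeSemiring using () renaming (_^_ to _^ᴬ_)
    open MonoidSum A.*-commutativeMonoid using (sum-cong-≗)

    con-hom : MonoidMorphisms.IsMonoidHomomorphism +-rawMonoid A.+-rawMonoid con
    con-hom = record
      { isMagmaHomomorphism = record
        { isRelHomomorphism = record
          { cong = λ a≈b → Q.≈⇒∼ (≋-intro λ φ → +-congʳ (*-congʳ a≈b)) }
        ; homo = λ a b → Q.≈⇒∼ (≋-intro λ φ → begin
            (a + b) * φ _ + 0#            ≈⟨ +-congʳ (distribʳ _ a b) ⟩
            (a * φ _ + b * φ _) + 0#      ≈⟨ +-assoc _ _ _ ⟩
            a * φ _ + (b * φ _ + 0#)      ∎)
        }
      ; ε-homo = Q.≈⇒∼ (≋-intro λ φ → trans (+-identityʳ _) (zeroˡ _))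
      }
      where open SetoidReasoning setoid

    open Slicing commutativeRing Q.quotientRing con con-hom r using (evalᴬ)

    ^ᴬ≡^ᴾ : ∀ f k → f ^ᴬ k ≡ f ^ᴾ k
    ^ᴬ≡^ᴾ f 0         = ≡.refl
    ^ᴬ≡^ᴾ f (ℕ.suc k) = ≡.cong (f *ᴾ_) (^ᴬ≡^ᴾ f k)

    evalᴬ-var : ∀ (f : Poly n) → evalᴬ f var A.≈ f
    evalᴬ-var []            = A.refl
    evalᴬ-var ((a , e) ∷ f) = A.+-cong {y = (a , e) ∷ []}
      (A.trans
        (A.reflexive (≡.cong (con a *ᴾ_)
          (sum-cong-≗ (λ i → ^ᴬ≡^ᴾ (var i) (Vec.lookup e i)))))
        (Q.≈⇒∼ (P.sym (term≋ n a e))))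
      (evalᴬ-var f)

    -- In the quotient by I, `f` is its own value at the variables, which there satisfy x^q = x; by
    -- `evalᴬ-vanish` this value is zero.
    vanish⇒∈ : (∀ v → I (var v ^ᴾ q -ᴾ var v)) → ∀ f → (∀ s → eval f s ≈ 0#) → I f
    vanish⇒∈ x^q-x∈I f f≈0 = Q.∼0⇒∈ (A.trans (A.sym (evalᴬ-var f))
      (evalᴬ-vanish Q.quotientRing con con-hom f f≈0 var
        (λ v → Q.mk∼ (≡.subst (λ g → I (g -ᴾ var v)) (≡.sym (^ᴬ≡^ᴾ (var v) q)) (x^q-x∈I v)))))

    -- If f vanishes on the common zeros of g and gs, then f (1 - g^(q-1))
    -- vanishes on those of gs.
    nullstellensatz : (∀ v → I (var v ^ᴾ q -ᴾ var v)) → ∀ gs → All I gs →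
                      ∀ f → (∀ s → Vanish gs s → eval f s ≈ 0#) → I f
    nullstellensatz x^q-x∈I []       []             f f≈0 =
      vanish⇒∈ x^q-x∈I f (λ s → f≈0 s [])
    nullstellensatz x^q-x∈I (g ∷ gs) (g∈I ∷ gs⊆I) f f≈0 =
      resp split (+-closed f[1-g^]∈I (*-closed f (*-closed (g ^ᴾ r) g∈I)))
      where
      -- This is g^(q-1) with the last factor split off on the right, so that `*-closed` gives its
      -- membership in I directly.
      h : Poly n
      h = g ^ᴾ r *ᴾ g
      eval-h : ∀ s → eval h s ≈ eval g s ^ ℕ.suc r
      eval-h s = trans (eval-* (g ^ᴾ r) g s)
        (trans (*-congʳ (eval-^ g r s)) (*-comm _ _))
      vanishes : ∀ s → Vanish gs s → eval (f *ᴾ (1ᴾ -ᴾ h)) s ≈ 0#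
      vanishes s gs≈0 with eval g s ≈? 0#
      ... | yes g≈0 = trans (eval-* f (1ᴾ -ᴾ h) s)
        (trans (*-congʳ (f≈0 s (g≈0 ∷ gs≈0))) (zeroˡ _))
      ... | no  g≉0 = trans (eval-* f (1ᴾ -ᴾ h) s)
        (trans (*-congˡ (trans (eval-minus 1ᴾ h s) (trans
          (+-cong (eval-con 1# s) (-‿cong (trans (eval-h s) (fermat g≉0))))
          (-‿inverseʳ 1#)))) (zeroʳ _))
      f[1-g^]∈I : I (f *ᴾ (1ᴾ -ᴾ h))
      f[1-g^]∈I = nullstellensatz x^q-x∈I gs gs⊆I (f *ᴾ (1ᴾ -ᴾ h)) vanishes
      split : f *ᴾ (1ᴾ -ᴾ h) +ᴾ f *ᴾ h P.≈ f
      split = P.trans (P.sym (P.distribˡ f (1ᴾ -ᴾ h) h)) (P.trans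
        (P.*-congˡ {f} (P.trans (P.+-assoc 1ᴾ (-ᴾ h) h) (P.trans
          (P.+-congˡ {1ᴾ} (P.-‿inverseˡ h)) (P.+-identityʳ 1ᴾ))))
        (P.*-identityʳ f))

funToFin-cong : ∀ {m n} {f g : Fin m → Fin n} → (∀ i → f i ≡ g i) →
                Fin.funToFin f ≡ Fin.funToFin g
funToFin-cong {0}       f≗g = ≡.refl
funToFin-cong {ℕ.suc m} f≗g = ≡.cong₂ Fin.combine (f≗g zero) (funToFin-cong (f≗g ∘ suc))

-- Applied to the zeros of an ideal among the q^n points: `injective` keeps distinct indicator
-- polynomials apart, for independence, and `surjective` ensures that no zero is left out, for
-- spanning.
record Enumeration {m p} (P : Fin m → Set p) : Set p where
  field
    size       : ℕ
    element    : Fin size → Fin m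
    injective  : ∀ {i j} → element i ≡ element j → i ≡ j
    satisfies  : ∀ i → P (element i)
    surjective : ∀ j → P j → ∃[ i ] element i ≡ j

enumerate : ∀ {m p} {P : Fin m → Set p} → Unary.Decidable P → Enumeration P
enumerate {0} P? = record
  { size = 0 ; element = λ () ; injective = λ { {()} } ; satisfies = λ () ; surjective = λ () }
enumerate {ℕ.suc m} {P = P} P? with P? zero | enumerate (P? ∘ suc)
... | no ¬P₀ | E = record
  { size       = size
  ; element    = suc ∘ element
  ; injective  = injective ∘ Fin.suc-injective
  ; satisfies  = satisfies
  ; surjective = λ { zero P₀ → contradiction P₀ ¬P₀
                   ; (suc j) Pⱼ → let i , eq = surjective j Pⱼ in i , ≡.cong suc eq }
  }
  where open Enumeration E
... | yes P₀ | E = record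
  { size       = ℕ.suc size
  ; element    = el
  ; injective  = λ {i} {j} → el-injective i j
  ; satisfies  = λ { zero → P₀ ; (suc i) → satisfies i }
  ; surjective = λ { zero P₀ → zero , ≡.refl
                   ; (suc j) Pⱼ → let i , eq = surjective j Pⱼ in suc i , ≡.cong suc eq }
  }
  where
  open Enumeration E
  el : Fin (ℕ.suc size) → Fin (ℕ.suc m)
  el zero    = zero
  el (suc i) = suc (element i)
  el-injective : ∀ i j → el i ≡ el j → i ≡ j
  el-injective zero    zero    eq = ≡.refl
  el-injective (suc i) (suc j) eq = ≡.cong suc (injective (Fin.suc-injective eq))

-- Ideals whose zeros are cut out by finitely many members

module FinitelyCut {c ℓ r} (K : FiniteField c ℓ (ℕ.suc (ℕ.suc r))) (n : ℕ) where

  open FiniteField K hiding (zero)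
  open Polynomials commutativeRing
  open PolynomialRing commutativeRing
  open Evaluation commutativeRing
  open PolynomialIdeals commutativeRing n
  open FiniteFieldProperties K
  open Nullstellensatz K n
  open Ideals n
  open ExpProperties commutativeSemiring using (_^_; ^-congˡ)
  open SumProperties semiring using (sum; sum-cong-≋; sum-replicate-zero)
  open MonoidSum *-commutativeMonoid using () renaming
    (sum-cong-≋ to product-cong; sum-replicate-zero to product-1)
  open MonoidHomomorphism +-commutativeMonoid using (sum-single)
  open RingProperties ring

  private variable
    a b : Level
    I : Pred (Poly n) a
    J : Pred (Poly n) b

  -- A finite list of members with no further common zeros is the input that `nullstellensatz` asks
  -- for, and the property passes to sums of ideals. Moreover `Vanish equations` is decidable,
  -- whereas `AlgebraicSet I` quantifies over all members of I; this is what allows the zeros to be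
  -- enumerated.
  record FinitelyCut (I : Pred (Poly n) a) : Set (c ⊔ ℓ ⊔ a) where
    field
      isIdeal    : IsIdealᴾ I
      equations  : List (Poly n)
      equations⊆ : All I equations
      cut        : ∀ s → Vanish equations s → AlgebraicSet I s

  -- The generators need not generate ⟨ S ⟩, they only have the same zeros as S;
  -- thus S may be indexed by all of K and the generators by Fin q.
  record FinitelyGenerated (S : Pred (Poly n) a) : Set (c ⊔ ℓ ⊔ a) where
    field
      generators  : List (Poly n)
      generators⊆ : All S generators
      cut         : ∀ s → Vanish generators s → ∀ f → S f → eval f s ≈ 0#

  algebraicSet-+ᴵ : ∀ s → AlgebraicSet I s → AlgebraicSet J s → AlgebraicSet (I +ᴵ J) s
  algebraicSet-+ᴵ s I≈0 J≈0 f (g , h , g∈I , h∈J , f≈) = trans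
    (eval-cong {f = f} {g +ᴾ h} (mk≋ f≈) s) (trans (eval-+ g h s)
      (trans (+-cong (I≈0 g g∈I) (J≈0 h h∈J)) (+-identityˡ 0#)))

  algebraicSet-⟨⟩ : ∀ {S : Pred (Poly n) a} s → (∀ f → S f → eval f s ≈ 0#) →
                    AlgebraicSet ⟨ S ⟩ s
  algebraicSet-⟨⟩ s S≈0 f (k , h , g , g∈S , f≈) = trans
    (eval-cong {f = f} {∑ (λ i → h i *ᴾ g i)} (mk≋ f≈) s)
    (trans (eval-∑ (λ i → h i *ᴾ g i) s) (trans
      (sum-cong-≋ (λ i → trans (eval-* (h i) (g i) s)
        (trans (*-congˡ (S≈0 (g i) (g∈S i))) (zeroʳ _))))
      (sum-replicate-zero k)))

  ⟨⟩-cut : ∀ {S : Pred (Poly n) a} → FinitelyGenerated S → FinitelyCut ⟨ S ⟩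
  ⟨⟩-cut {S = S} S-fg = record
    { isIdeal    = ⟨⟩-ideal S
    ; equations  = generators
    ; equations⊆ = All.map (generator S) generators⊆
    ; cut        = λ s gs≈0 → algebraicSet-⟨⟩ s (cut s gs≈0)
    }
    where open FinitelyGenerated S-fg

  +ᴵ-cut : FinitelyCut I → FinitelyCut J → FinitelyCut (I +ᴵ J)
  +ᴵ-cut I-cut J-cut = record
    { isIdeal    = +ᴵ-ideal I.isIdeal J.isIdeal
    ; equations  = I.equations ++ J.equations
    ; equations⊆ = All.++⁺ (All.map (+ᴵ-left J.isIdeal) I.equations⊆)
                           (All.map (+ᴵ-right I.isIdeal) J.equations⊆)
    ; cut        = λ s gs≈0 → let I≈0 , J≈0 = All.++⁻ I.equations gs≈0 in
                     algebraicSet-+ᴵ s (I.cut s I≈0) (J.cut s J≈0)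
    }
    where
    module I = FinitelyCut I-cut
    module J = FinitelyCut J-cut

  -- This and the next three combinators follow the shape of the predicates that define the
  -- generators: equations, alternatives, decidable side conditions and existentials over `Fin`.
  fg-≡ : ∀ g → FinitelyGenerated (_≡ g)
  fg-≡ g = record
    { generators  = g ∷ []
    ; generators⊆ = ≡.refl ∷ []
    ; cut         = λ { s (g≈0 ∷ []) f ≡.refl → g≈0 }
    }

  fg-⊎ : ∀ {S : Pred (Poly n) a} {T : Pred (Poly n) b} →
         FinitelyGenerated S → FinitelyGenerated T → FinitelyGenerated (λ f → S f ⊎ T f)
  fg-⊎ S-fg T-fg = record
    { generators  = S.generators ++ T.generators
    ; generators⊆ = All.++⁺ (All.map inj₁ S.generators⊆) (All.map inj₂ T.generators⊆)
    ; cut         = λ s gs≈0 f → λ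
        { (inj₁ f∈S) → S.cut s (All.++⁻ˡ S.generators gs≈0) f f∈S
        ; (inj₂ f∈T) → T.cut s (All.++⁻ʳ S.generators gs≈0) f f∈T }
    }
    where
    module S = FinitelyGenerated S-fg
    module T = FinitelyGenerated T-fg

  fg-× : ∀ {d} {D : Set d} {S : Pred (Poly n) a} → Dec D →
         FinitelyGenerated S → FinitelyGenerated (λ f → D × S f)
  fg-× (no ¬D) S-fg = record
    { generators  = []
    ; generators⊆ = []
    ; cut         = λ s _ f (d , _) → contradiction d ¬D
    }
  fg-× (yes d) S-fg = record
    { generators  = generators
    ; generators⊆ = All.map (d ,_) generators⊆
    ; cut         = λ s gs≈0 f (_ , f∈S) → cut s gs≈0 f f∈S
    }
    where open FinitelyGenerated S-fg

  fg-∃ : ∀ {m} {S : Fin m → Pred (Poly n) a} → (∀ i → FinitelyGenerated (S i)) →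
         FinitelyGenerated (λ f → ∃[ i ] S i f)
  fg-∃ {m = 0} S-fg = record
    { generators = [] ; generators⊆ = [] ; cut = λ { s _ f (() , _) } }
  fg-∃ {m = ℕ.suc m} S-fg = record
    { generators  = Z.generators ++ T.generators
    ; generators⊆ = All.++⁺ (All.map (zero ,_) Z.generators⊆)
                            (All.map (λ (i , f∈S) → suc i , f∈S) T.generators⊆)
    ; cut         = λ s gs≈0 f → λ
        { (zero  , f∈S) → Z.cut s (All.++⁻ˡ Z.generators gs≈0) f f∈S
        ; (suc i , f∈S) → T.cut s (All.++⁻ʳ Z.generators gs≈0) f (i , f∈S) }
    }
    where
    module Z = FinitelyGenerated (S-fg zero)
    module T = FinitelyGenerated (fg-∃ (S-fg ∘ suc))

  -- Serves to enlarge a family with parameters in `Fin q` to one with parameters in the whole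
  -- carrier, provided that the zeros stay the same.
  fg-⊇ : ∀ {S : Pred (Poly n) a} {T : Pred (Poly n) b} → FinitelyGenerated S →
         (∀ {f} → S f → T f) →
         (∀ s → (∀ f → S f → eval f s ≈ 0#) → ∀ f → T f → eval f s ≈ 0#) →
         FinitelyGenerated T
  fg-⊇ S-fg S⊆T T-cut = record
    { generators  = generators
    ; generators⊆ = All.map S⊆T generators⊆
    ; cut         = λ s gs≈0 → T-cut s (cut s gs≈0)
    }
    where open FinitelyGenerated S-fg

  module _ {I : Pred (Poly n) a} (I-cut : FinitelyCut I)
           (x^q-x∈I : ∀ v → I (var v ^ᴾ q -ᴾ var v)) where

    open FinitelyCut I-cut

    vanishing⇒∈ : ∀ f → (∀ s → AlgebraicSet I s → eval f s ≈ 0#) → I f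
    vanishing⇒∈ f f≈0 = nullstellensatz isIdeal x^q-x∈I equations equations⊆ f
      (λ s gs≈0 → f≈0 s (cut s gs≈0))

    radical : Radical I
    radical f k f^k∈I = vanishing⇒∈ f λ s s∈V →
      ^≈0⇒≈0 _ k (trans (sym (eval-^ f k s)) (s∈V (f ^ᴾ k) f^k∈I))

    algebraicSet⇒Vanish : ∀ s → AlgebraicSet I s → Vanish equations s
    algebraicSet⇒Vanish s s∈V = All.map (s∈V _) equations⊆

    -- By Fermat, 1 - (t - a)^(q-1) is 1 at t = a and 0 at every other t in K.
    factor : Vector Carrier n → Fin n → Poly n
    factor s v = 1ᴾ -ᴾ (var v -ᴾ con (s v)) ^ᴾ ℕ.suc r

    indicator : Vector Carrier n → Poly n
    indicator s = ∏ (factor s)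

    eval-factor : ∀ s t v → eval (factor s v) t ≈ 1# - (t v - s v) ^ ℕ.suc r
    eval-factor s t v = trans (eval-minus 1ᴾ ((var v -ᴾ con (s v)) ^ᴾ ℕ.suc r) t)
      (+-cong (eval-con 1# t) (-‿cong (trans (eval-^ (var v -ᴾ con (s v)) (ℕ.suc r) t)
        (^-congˡ (ℕ.suc r) (trans (eval-minus (var v) (con (s v)) t)
          (+-cong (eval-var v t) (-‿cong (eval-con (s v) t))))))))

    indicator-1 : ∀ s → eval (indicator s) s ≈ 1#
    indicator-1 s = trans (eval-∏ (factor s) s) (trans
      (product-cong (λ v → trans (eval-factor s s v)
        (trans (+-congˡ (trans (-‿cong (0^suc r (-‿inverseʳ (s v)))) -0#≈0#))
          (+-identityʳ 1#))))
      (product-1 n))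

    indicator-0 : ∀ s t v → ¬ t v ≈ s v → eval (indicator s) t ≈ 0#
    indicator-0 s t v tv≉sv = trans (eval-∏ (factor s) t)
      (factor≈0 (λ v → eval (factor s v) t) v (trans (eval-factor s t v)
        (trans (+-congˡ (-‿cong (fermat (tv≉sv ∘ x∙y⁻¹≈ε⇒x≈y _ _)))) (-‿inverseʳ 1#))))

    private
      pt : Fin (q ℕ.^ n) → Vector Carrier n
      pt i v = el (Fin.finToFun i v)

      separate : ∀ i j → ¬ i ≡ j → ∃[ v ] ¬ pt j v ≈ pt i v
      separate i j i≢j = Fin.¬∀⟶∃¬ n _ (λ v → pt j v ≈? pt i v) λ all → i≢j
        (≡.trans (≡.sym (Fin.funToFin-finToFin {n} {q} i)) (≡.trans
          (funToFin-cong (λ v → ≡.sym (el-injective (all v))))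
          (Fin.funToFin-finToFin {n} {q} j)))

      locate : ∀ s → ∃[ i ] (∀ v → pt i v ≈ s v)
      locate s = Fin.funToFin (idx ∘ s) , λ v →
        trans (reflexive (≡.cong el (Fin.finToFun-funToFin (idx ∘ s) v))) (el-idx (s v))

      open Enumeration
        (enumerate (λ i → All.all? (λ g → eval g (pt i) ≈? 0#) equations))

      p : Fin size → Vector Carrier n
      p i = pt (element i)

      basis : Fin size → Poly n
      basis i = indicator (p i)

      combination : Vector Carrier size → Poly n
      combination k = ∑ (λ i → con (k i) *ᴾ basis i)

      -- Lagrange interpolation: evaluations at the zeros are dual to the indicators. Hence the
      -- coefficients of a combination can be read off, and the values of any `f` serve as its
      -- coordinates in the quotient.
      eval-combination : ∀ k j → eval (combination k) (p j) ≈ k j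
      eval-combination k j = begin
        eval (combination k) (p j)
          ≈⟨ eval-∑ (λ i → con (k i) *ᴾ basis i) (p j) ⟩
        sum (λ i → eval (con (k i) *ᴾ basis i) (p j))
          ≈⟨ sum-cong-≋ (λ i → trans (eval-* (con (k i)) (basis i) (p j))
               (*-congʳ (eval-con (k i) (p j)))) ⟩
        sum (λ i → k i * eval (basis i) (p j))
          ≈⟨ sum-single j _ (λ i j≢i →
               let v , neq = separate (element i) (element j) (λ eq → j≢i (≡.sym (injective eq)))
               in trans (*-congˡ (indicator-0 (p i) (p j) v neq)) (zeroʳ (k i))) ⟩
        k j * eval (basis j) (p j)
          ≈⟨ trans (*-congˡ (indicator-1 (p j))) (*-identityʳ (k j)) ⟩
        k j ∎
        where open SetoidReasoning setoid

    zeroDimensional : ZeroDimensional I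
    zeroDimensional = size , basis , spanning , independent
      where
      spanning : ∀ f → Σ[ k ∈ Vector Carrier size ] I (f -ᴾ combination k)
      spanning f = k , vanishing⇒∈ (f -ᴾ combination k) λ s s∈V →
        -- An arbitrary zero agrees with an enumerated point only up to `≈`, so the equations are
        -- first transported to that point, which makes it one of the `p j`.
        let i , i≈s = locate s
            j , eq  = surjective i (All.map (λ {g} g≈0 → trans (eval-congʳ g i≈s) g≈0)
                        (algebraicSet⇒Vanish s s∈V))
            j≈s : ∀ v → p j v ≈ s v
            j≈s v = trans (reflexive (≡.cong (λ i → pt i v) eq)) (i≈s v)
        in trans (eval-congʳ (f -ᴾ combination k) (λ v → sym (j≈s v)))
             (trans (eval-minus f (combination k) (p j))
               (trans (+-congˡ (-‿cong (eval-combination k j))) (-‿inverseʳ (k j))))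
        where
        k : Vector Carrier size
        k i = eval f (p i)
      independent : ∀ k → I (combination k) → ∀ i → k i ≈ 0#
      independent k k∈I i = trans (sym (eval-combination k i))
        (cut (p i) (satisfies i) (combination k) k∈I)

-- Coefficient arrays and local permutation polynomials

module Coefficients {c ℓ} (R : CommutativeRing c ℓ) where

  open CommutativeRing R hiding (zero)
  open Polynomials R
  open PolynomialRing R
  open Evaluation R
  open Univariate R
  open Ideals 2
  private module P = CommutativeRing (polyRing 2)
  open ExpProperties commutativeSemiring using (_^_; ^-congˡ)
  open SumProperties semiring using (sum; sum-cong-≋; sum-replicate-zero)
  open SumProperties P.semiring using () renaming (sum-cong-≋ to ∑-cong)
  open MonoidHomomorphism +-commutativeMonoid using (sum-single)
  open SetoidReasoning setoid

  Coefficients : ℕ → Set c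
  Coefficients m = Fin m → Fin m → Carrier

  cell : Carrier → ℕ → ℕ → Poly 2
  cell a k l = con a *ᴾ var zero ^ᴾ k *ᴾ var (suc zero) ^ᴾ l

  -- For m = q - 1 this unfolds to `toPoly`. The size is a parameter because a local permutation
  -- polynomial is first expanded with m = q, before its coefficients at exponent q - 1 are known to
  -- vanish.
  grid : ∀ m → Coefficients m → Poly 2
  grid m M = ∑ λ (i : Fin m) → ∑ λ (j : Fin m) → cell (M i j) (toℕ i) (toℕ j)

  bilinear : ∀ {m} → Coefficients m → Carrier → Carrier → Carrier
  bilinear M a b = sum λ i → sum λ j → M i j * a ^ toℕ i * b ^ toℕ j

  eval-grid : ∀ m (M : Coefficients m) s →
              eval (grid m M) s ≈ bilinear M (s zero) (s (suc zero))
  eval-grid m M s = trans (eval-∑ (λ i → ∑ λ j → cell (M i j) (toℕ i) (toℕ j)) s)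
    (sum-cong-≋ λ i → trans (eval-∑ (λ j → cell (M i j) (toℕ i) (toℕ j)) s)
      (sum-cong-≋ λ j → eval-cell (M i j) (toℕ i) (toℕ j)))
    where
    eval-cell : ∀ a k l → eval (cell a k l) s ≈ a * s zero ^ k * s (suc zero) ^ l
    eval-cell a k l = trans (eval-* (con a *ᴾ var zero ^ᴾ k) (var (suc zero) ^ᴾ l) s)
      (*-cong
        (trans (eval-* (con a) (var zero ^ᴾ k) s)
          (*-cong (eval-con a s)
            (trans (eval-^ (var zero) k s) (^-congˡ k (eval-var zero s)))))
        (trans (eval-^ (var (suc zero)) l s) (^-congˡ l (eval-var (suc zero) s))))

  bilinear-poly : ∀ {m} (M : Coefficients m) a b →
                  bilinear M a b ≈ sum (λ i → a ^ toℕ i * poly (M i) b)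
  bilinear-poly M a b = sum-cong-≋ λ i → trans
    (sum-cong-≋ (λ j → trans (*-congʳ (*-comm (M i j) (a ^ toℕ i))) (*-assoc _ _ _)))
    (sym (SumProperties.*-distribˡ-sum semiring (a ^ toℕ i) (λ j → M i j * b ^ toℕ j)))

  cell≋ : ∀ a k l → cell a k l ≋ (a , k ∷ l ∷ []) ∷ []
  cell≋ a k l = P.sym (P.trans (term≋ 2 a (k ∷ l ∷ []))
    (P.trans
      (P.*-congˡ {con a} (P.*-congˡ {var zero ^ᴾ k} (P.*-identityʳ (var (suc zero) ^ᴾ l))))
      (P.sym (P.*-assoc (con a) (var zero ^ᴾ k) (var (suc zero) ^ᴾ l)))))

  coeff-∑ : ∀ {m} (f : Vector (Poly 2) m) e → coeff (∑ f) e ≈ sum (λ i → coeff (f i) e)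
  coeff-∑ {0}       f e = refl
  coeff-∑ {ℕ.suc m} f e = begin
    coeff (f zero ++ ∑ (f ∘ suc)) e
      ≈⟨ coeff-lin (f zero ++ ∑ (f ∘ suc)) e ⟩
    lin (f zero ++ ∑ (f ∘ suc)) (δ e)
      ≈⟨ lin-++ (f zero) (∑ (f ∘ suc)) (δ e) ⟩
    lin (f zero) (δ e) + lin (∑ (f ∘ suc)) (δ e)
      ≈⟨ +-cong (coeff-lin (f zero) e) (coeff-lin (∑ (f ∘ suc)) e) ⟨
    coeff (f zero) e + coeff (∑ (f ∘ suc)) e
      ≈⟨ +-congˡ (coeff-∑ (f ∘ suc) e) ⟩
    coeff (f zero) e + sum (λ i → coeff (f (suc i)) e) ∎

  monomial-coeff : ∀ {n} → Carrier → Monomial n → Monomial n → Carrier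
  monomial-coeff a e d = if does (Vec.≡-dec ℕ._≟_ e d) then a else 0#

  monomial-coeff-≡ : ∀ {n} a (e : Monomial n) → monomial-coeff a e e ≡ a
  monomial-coeff-≡ a e = ≡.cong (if_then a else 0#) (dec-true (Vec.≡-dec ℕ._≟_ e e) ≡.refl)

  monomial-coeff-≢ : ∀ {n} a (e d : Monomial n) → ¬ e ≡ d → monomial-coeff a e d ≡ 0#
  monomial-coeff-≢ a e d e≢d =
    ≡.cong (if_then a else 0#) (dec-false (Vec.≡-dec ℕ._≟_ e d) e≢d)

  coeff-grid : ∀ m (M : Coefficients m) e →
               coeff (grid m M) e ≈
               sum (λ i → sum (λ j → monomial-coeff (M i j) (toℕ i ∷ toℕ j ∷ []) e))
  coeff-grid m M e = trans (coeff-∑ (λ i → ∑ λ j → cell (M i j) (toℕ i) (toℕ j)) e)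
    (sum-cong-≋ λ i → trans (coeff-∑ (λ j → cell (M i j) (toℕ i) (toℕ j)) e)
      (sum-cong-≋ λ j → trans (coeff-≈ (cell≋ (M i j) (toℕ i) (toℕ j)) e) (+-identityʳ _)))

  coeff-grid-in : ∀ m (M : Coefficients m) i j →
                  coeff (grid m M) (toℕ i ∷ toℕ j ∷ []) ≈ M i j
  coeff-grid-in m M i j = begin
    coeff (grid m M) e
      ≈⟨ coeff-grid m M e ⟩
    sum (λ k → sum (λ l → monomial-coeff (M k l) (toℕ k ∷ toℕ l ∷ []) e))
      ≈⟨ sum-single i _ (λ k i≢k → trans
           (sum-cong-≋ (λ l → reflexive (monomial-coeff-≢ (M k l) (toℕ k ∷ toℕ l ∷ []) e
             (λ eq → i≢k (Fin.toℕ-injective (≡.sym (Vec.∷-injectiveˡ eq)))))))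
           (sum-replicate-zero m)) ⟩
    sum (λ l → monomial-coeff (M i l) (toℕ i ∷ toℕ l ∷ []) e)
      ≈⟨ sum-single j _ (λ l j≢l → reflexive (monomial-coeff-≢ (M i l) (toℕ i ∷ toℕ l ∷ []) e
           (λ eq → j≢l (Fin.toℕ-injective (≡.sym
             (Vec.∷-injectiveˡ (Vec.∷-injectiveʳ eq))))))) ⟩
    monomial-coeff (M i j) e e
      ≡⟨ monomial-coeff-≡ (M i j) e ⟩
    M i j ∎
    where
    e : Monomial 2
    e = toℕ i ∷ toℕ j ∷ []

  coeff-grid-out : ∀ m (M : Coefficients m) k l → ¬ (k ℕ.< m × l ℕ.< m) →
                   coeff (grid m M) (k ∷ l ∷ []) ≈ 0#
  coeff-grid-out m M k l out = trans (coeff-grid m M (k ∷ l ∷ [])) (trans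
    (sum-cong-≋ (λ i → trans (sum-cong-≋ (λ j → reflexive
      (monomial-coeff-≢ (M i j) (toℕ i ∷ toℕ j ∷ []) (k ∷ l ∷ [])
      λ { ≡.refl → out (Fin.toℕ<n i , Fin.toℕ<n j) }))) (sum-replicate-zero m)))
    (sum-replicate-zero m))

  grid-cong : ∀ m {M M′ : Coefficients m} → (∀ i j → M i j ≈ M′ i j) → grid m M ≋ grid m M′
  grid-cong m {M} {M′} M≈M′ =
    ∑-cong {m} {λ i → ∑ λ j → cell (M i j) (toℕ i) (toℕ j)} λ i →
    ∑-cong {m} {λ j → cell (M i j) (toℕ i) (toℕ j)} λ j →
    P.trans (cell≋ (M i j) (toℕ i) (toℕ j)) (P.trans
      (≋-intro λ φ → +-congʳ (*-congʳ (M≈M′ i j)))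
      (P.sym (cell≋ (M′ i j) (toℕ i) (toℕ j))))

  coefficients : ∀ m → Poly 2 → Coefficients m
  coefficients m f i j = coeff f (toℕ i ∷ toℕ j ∷ [])

  ≋-grid : ∀ m f → (∀ k l → ¬ (k ℕ.< m × l ℕ.< m) → coeff f (k ∷ l ∷ []) ≈ 0#) →
           f ≋ grid m (coefficients m f)
  ≋-grid m f out = mk≋ equal
    where
    equal : f ≈ᴾ grid m (coefficients m f)
    equal (k ∷ l ∷ []) with k ℕ.<? m | l ℕ.<? m
    ... | yes k<m | yes l<m = begin
      coeff f (k ∷ l ∷ [])
        ≡⟨ ≡.cong₂ (λ k l → coeff f (k ∷ l ∷ []))
             (Fin.toℕ-fromℕ< k<m) (Fin.toℕ-fromℕ< l<m) ⟨
      coefficients m f (Fin.fromℕ< k<m) (Fin.fromℕ< l<m)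
        ≈⟨ coeff-grid-in m (coefficients m f) (Fin.fromℕ< k<m) (Fin.fromℕ< l<m) ⟨
      coeff (grid m (coefficients m f))
            (toℕ (Fin.fromℕ< k<m) ∷ toℕ (Fin.fromℕ< l<m) ∷ [])
        ≡⟨ ≡.cong₂ (λ k l → coeff (grid m (coefficients m f)) (k ∷ l ∷ []))
             (Fin.toℕ-fromℕ< k<m) (Fin.toℕ-fromℕ< l<m) ⟩
      coeff (grid m (coefficients m f)) (k ∷ l ∷ []) ∎
    ... | no k≮m  | _       = trans (out k l (k≮m ∘ proj₁))
      (sym (coeff-grid-out m (coefficients m f) k l (k≮m ∘ proj₁)))
    ... | yes _   | no l≮m  = trans (out k l (l≮m ∘ proj₂))
      (sym (coeff-grid-out m (coefficients m f) k l (l≮m ∘ proj₂)))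

-- Zeros of the ideals as Latin, symmetric and degree-d arrays

module LatinSquares {c ℓ r} (K : FiniteField c ℓ (ℕ.suc (ℕ.suc r))) where

  open FiniteField K hiding (zero)
  open LocalPermutation K
  open X
  open PolynomialRing commutativeRing
  open Evaluation commutativeRing
  open PolynomialIdeals commutativeRing N
  open FiniteFieldProperties K
  open FinitelyCut K N
  open Coefficients commutativeRing using
    (bilinear; eval-grid)
  open Univariate commutativeRing using (sum-minus)
  open ExpProperties commutativeSemiring using (_^_)
  open SumProperties semiring using (sum; sum-cong-≋; ∑-comm)
  open RingProperties ring
  open SetoidReasoning setoid

  entry : Vector Carrier N → Index → Index → Carrier
  entry s i j = s (Fin.combine i j)

  square : Vector Carrier N → Carrier → Carrier → Carrier
  square s = bilinear (entry s)

  at-toPoly : ∀ s a b → at (toPoly s) a b ≈ square s a b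
  at-toPoly s a b = eval-grid (ℕ.suc r) (entry s) (Vec.lookup (a ∷ b ∷ []))

  at-congʳ : ∀ f {a a′ b b′} → a ≈ a′ → b ≈ b′ → at f a b ≈ at f a′ b′
  at-congʳ f a≈a′ b≈b′ = eval-congʳ f λ { zero → a≈a′ ; (suc zero) → b≈b′ }

  square-cong : ∀ s {a a′ b b′} → a ≈ a′ → b ≈ b′ → square s a b ≈ square s a′ b′
  square-cong s {a} {a′} {b} {b′} a≈a′ b≈b′ = trans (sym (at-toPoly s a b))
    (trans (at-congʳ (toPoly s) a≈a′ b≈b′) (at-toPoly s a′ b′))

  -- Injectivity in each variable, in the negative form that the ideal can express: by Fermat, `F`
  -- of a difference vanishes exactly where the difference does not.
  IsLatin : Vector Carrier N → Set (c ⊔ ℓ)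
  IsLatin s = ∀ a b c → ¬ a ≈ b →
    ¬ square s c a ≈ square s c b × ¬ square s a c ≈ square s b c

  IsSymmetric : Vector Carrier N → Set ℓ
  IsSymmetric s = ∀ i j → entry s i j ≈ entry s j i

  eval-F : ∀ f s → eval (F f) s ≈ eval f s ^ ℕ.suc r - 1#
  eval-F f s = trans (eval-minus (f ^ᴾ ℕ.suc r) 1ᴾ s)
    (+-cong (eval-^ f (ℕ.suc r) s) (-‿cong (eval-con 1# s)))

  F≈0⇒≉0 : ∀ f s → eval (F f) s ≈ 0# → ¬ eval f s ≈ 0#
  F≈0⇒≉0 f s F≈0 f≈0 = 1≉0 (begin
    1#                    ≈⟨ x∙y⁻¹≈ε⇒x≈y _ _ (trans (sym (eval-F f s)) F≈0) ⟨
    eval f s ^ ℕ.suc r    ≈⟨ 0^suc r f≈0 ⟩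
    0#                    ∎)

  ≉0⇒F≈0 : ∀ f s → ¬ eval f s ≈ 0# → eval (F f) s ≈ 0#
  ≉0⇒F≈0 f s f≉0 = trans (eval-F f s) (x≈y⇒x∙y⁻¹≈ε (fermat f≉0))

  eval-x : ∀ i j s → eval (x i j) s ≈ entry s i j
  eval-x i j s = eval-var (Fin.combine i j) s

  rowForm colForm : Carrier → Carrier → Carrier → Poly N
  rowForm a b c = ∑ λ i → ∑ λ j → con ((a ^ toℕ i - b ^ toℕ i) * c ^ toℕ j) *ᴾ x j i
  colForm a b c = ∑ λ i → ∑ λ j → con ((a ^ toℕ i - b ^ toℕ i) * c ^ toℕ j) *ᴾ x i j

  eval-form : ∀ (k : Index → Index → Carrier) (y : Index → Index → Poly N) s →
              eval (∑ λ i → ∑ λ j → con (k i j) *ᴾ y i j) s ≈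
              sum (λ i → sum (λ j → k i j * eval (y i j) s))
  eval-form k y s = trans (eval-∑ (λ i → ∑ λ j → con (k i j) *ᴾ y i j) s)
    (sum-cong-≋ λ i → trans (eval-∑ (λ j → con (k i j) *ᴾ y i j) s)
      (sum-cong-≋ λ j → trans (eval-* (con (k i j)) (y i j) s)
        (*-congʳ (eval-con (k i j) s))))

  sum-difference : ∀ {k l} (f g : Fin k → Fin l → Carrier) →
                   sum (λ i → sum (λ j → f i j - g i j)) ≈
                   sum (λ i → sum (f i)) - sum (λ i → sum (g i))
  sum-difference f g = trans (sum-cong-≋ (λ i → sum-minus (f i) (g i)))
    (sum-minus (λ i → sum (f i)) (λ i → sum (g i)))

  eval-rowForm : ∀ a b c s → eval (rowForm a b c) s ≈ square s c a - square s c b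
  eval-rowForm a b c s = begin
    eval (rowForm a b c) s
      ≈⟨ eval-form (λ i j → (a ^ toℕ i - b ^ toℕ i) * c ^ toℕ j) (λ i j → x j i) s ⟩
    sum (λ i → sum (λ j → (a ^ toℕ i - b ^ toℕ i) * c ^ toℕ j * eval (x j i) s))
      ≈⟨ sum-cong-≋ (λ i → sum-cong-≋ (λ j →
           trans (*-congˡ (eval-x j i s)) (expand (a ^ toℕ i) (b ^ toℕ i) (c ^ toℕ j) _))) ⟩
    sum (λ i → sum (λ j → term a i j - term b i j))
      ≈⟨ sum-difference (term a) (term b) ⟩
    sum (λ i → sum (term a i)) - sum (λ i → sum (term b i))
      -- The outer index of `rowForm` is the exponent of the second variable, while in `square` it
      -- is that of the first.
      ≈⟨ +-cong (∑-comm (term a)) (-‿cong (∑-comm (term b))) ⟩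
    square s c a - square s c b ∎
    where
    term : Carrier → Index → Index → Carrier
    term a i j = entry s j i * c ^ toℕ j * a ^ toℕ i
    expand : ∀ u v w e → (u - v) * w * e ≈ e * w * u - e * w * v
    expand u v w e = begin
      (u - v) * w * e       ≈⟨ trans (*-assoc _ w e) (*-congˡ (*-comm w e)) ⟩
      (u - v) * (e * w)     ≈⟨ *-comm _ _ ⟩
      e * w * (u - v)       ≈⟨ x[y-z]≈xy-xz (e * w) u v ⟩
      e * w * u - e * w * v ∎

  eval-colForm : ∀ a b c s → eval (colForm a b c) s ≈ square s a c - square s b c
  eval-colForm a b c s = begin
    eval (colForm a b c) s
      ≈⟨ eval-form (λ i j → (a ^ toℕ i - b ^ toℕ i) * c ^ toℕ j) x s ⟩
    sum (λ i → sum (λ j → (a ^ toℕ i - b ^ toℕ i) * c ^ toℕ j * eval (x i j) s))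
      ≈⟨ sum-cong-≋ (λ i → sum-cong-≋ (λ j →
           trans (*-congˡ (eval-x i j s)) (expand (a ^ toℕ i) (b ^ toℕ i) (c ^ toℕ j) _))) ⟩
    sum (λ i → sum (λ j → term a i j - term b i j))
      ≈⟨ sum-difference (term a) (term b) ⟩
    square s a c - square s b c ∎
    where
    term : Carrier → Index → Index → Carrier
    term a i j = entry s i j * a ^ toℕ i * c ^ toℕ j
    expand : ∀ u v w e → (u - v) * w * e ≈ e * u * w - e * v * w
    expand u v w e = begin
      (u - v) * w * e       ≈⟨ *-comm _ e ⟩
      e * ((u - v) * w)     ≈⟨ *-assoc e (u - v) w ⟨
      e * (u - v) * w       ≈⟨ *-congʳ (x[y-z]≈xy-xz e u v) ⟩
      (e * u - e * v) * w   ≈⟨ [y-z]x≈yx-zx w (e * u) (e * v) ⟩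
      e * u * w - e * v * w ∎

  Grow≈0⇒ : ∀ a b c s → eval (Grow a b c) s ≈ 0# → ¬ square s c a ≈ square s c b
  Grow≈0⇒ a b c s G≈0 eq = F≈0⇒≉0 (rowForm a b c) s G≈0
    (trans (eval-rowForm a b c s) (x≈y⇒x∙y⁻¹≈ε eq))

  Gcol≈0⇒ : ∀ a b c s → eval (Gcol a b c) s ≈ 0# → ¬ square s a c ≈ square s b c
  Gcol≈0⇒ a b c s G≈0 eq = F≈0⇒≉0 (colForm a b c) s G≈0
    (trans (eval-colForm a b c s) (x≈y⇒x∙y⁻¹≈ε eq))

  LatinGenerator FieldGenerator SymmetryGenerator : Pred (Poly N) _
  LatinGenerator f = ∃[ a ] ∃[ b ] ∃[ c ] ¬ a ≈ b × (f ≡ Grow a b c ⊎ f ≡ Gcol a b c)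
  FieldGenerator f = ∃[ i ] ∃[ j ] f ≡ x i j ^ᴾ q -ᴾ x i j
  SymmetryGenerator f = ∃[ i ] ∃[ j ] i Fin.< j × f ≡ x i j -ᴾ x j i

  DegreeGenerator : ℕ → Pred (Poly N) _
  DegreeGenerator d f = ∃[ i ] ∃[ j ] toℕ i ℕ.+ toℕ j ℕ.> d × f ≡ x i j

  latin⇒vanish : ∀ s → IsLatin s → ∀ f → LatinGenerator f → eval f s ≈ 0#
  latin⇒vanish s s-latin f (a , b , c , a≉b , inj₁ ≡.refl) = ≉0⇒F≈0 (rowForm a b c) s
    (λ eq → proj₁ (s-latin a b c a≉b)
      (x∙y⁻¹≈ε⇒x≈y _ _ (trans (sym (eval-rowForm a b c s)) eq)))
  latin⇒vanish s s-latin f (a , b , c , a≉b , inj₂ ≡.refl) = ≉0⇒F≈0 (colForm a b c) s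
    (λ eq → proj₂ (s-latin a b c a≉b)
      (x∙y⁻¹≈ε⇒x≈y _ _ (trans (sym (eval-colForm a b c s)) eq)))

  field⇒vanish : ∀ s f → FieldGenerator f → eval f s ≈ 0#
  field⇒vanish s f (i , j , ≡.refl) = trans (eval-minus (x i j ^ᴾ q) (x i j) s)
    (x≈y⇒x∙y⁻¹≈ε (trans (eval-^ (x i j) q s) (frobenius (eval (x i j) s))))

  symmetric⇒vanish : ∀ s → IsSymmetric s → ∀ f → SymmetryGenerator f → eval f s ≈ 0#
  symmetric⇒vanish s s-sym f (i , j , _ , ≡.refl) = trans (eval-minus (x i j) (x j i) s)
    (x≈y⇒x∙y⁻¹≈ε (trans (eval-x i j s) (trans (s-sym i j) (sym (eval-x j i s)))))

  LatinGeneratorᶠ : Pred (Poly N) _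
  LatinGeneratorᶠ f = ∃[ i ] ∃[ j ] ∃[ k ] ¬ el i ≈ el j ×
    (f ≡ Grow (el i) (el j) (el k) ⊎ f ≡ Gcol (el i) (el j) (el k))

  -- `Grow a b c` and its version at the representatives `el (idx _)` are different formal sums, so
  -- the comparison goes through the values of `square`, which respect `≈`.
  vanish⇒latin : ∀ s → (∀ f → LatinGeneratorᶠ f → eval f s ≈ 0#) → IsLatin s
  vanish⇒latin s gs≈0 a b c a≉b =
      (λ eq → Grow≈0⇒ (el i) (el j) (el k) s (gs≈0 _ (i , j , k , i≉j , inj₁ ≡.refl))
        (trans (square-cong s (el-idx c) (el-idx a)) (trans eq
          (sym (square-cong s (el-idx c) (el-idx b))))))
    , (λ eq → Gcol≈0⇒ (el i) (el j) (el k) s (gs≈0 _ (i , j , k , i≉j , inj₂ ≡.refl))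
        (trans (square-cong s (el-idx a) (el-idx c)) (trans eq
          (sym (square-cong s (el-idx b) (el-idx c))))))
    where
    i j k : Fin (ℕ.suc (ℕ.suc r))
    i = idx a
    j = idx b
    k = idx c
    i≉j : ¬ el i ≈ el j
    i≉j eq = a≉b (trans (sym (el-idx a)) (trans eq (el-idx b)))

  LatinGeneratorᶠ⊆ : ∀ {f} → LatinGeneratorᶠ f → LatinGenerator f
  LatinGeneratorᶠ⊆ (i , j , k , i≉j , eq) = el i , el j , el k , i≉j , eq

  𝒥-cut : FinitelyCut 𝒥
  𝒥-cut = +ᴵ-cut
    (⟨⟩-cut {S = LatinGenerator} (fg-⊇ {S = LatinGeneratorᶠ}
      (fg-∃ λ i → fg-∃ λ j → fg-∃ λ k → fg-× (¬? (el i ≈? el j))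
        (fg-⊎ (fg-≡ (Grow (el i) (el j) (el k))) (fg-≡ (Gcol (el i) (el j) (el k)))))
      LatinGeneratorᶠ⊆
      -- A zero of the finite family is Latin, and a Latin array is a zero of every generator,
      -- whatever its parameters in K.
      (λ s gs≈0 → latin⇒vanish s (vanish⇒latin s gs≈0))))
    (⟨⟩-cut {S = FieldGenerator} (fg-∃ λ i → fg-∃ λ j → fg-≡ (x i j ^ᴾ q -ᴾ x i j)))

  symmetryIdeal-cut : FinitelyCut symmetryIdeal
  symmetryIdeal-cut = ⟨⟩-cut {S = SymmetryGenerator}
    (fg-∃ λ i → fg-∃ λ j → fg-× (i Fin.<? j) (fg-≡ (x i j -ᴾ x j i)))

  degreeIdeal-cut : ∀ d → FinitelyCut ⟨ DegreeGenerator d ⟩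
  degreeIdeal-cut d = ⟨⟩-cut {S = DegreeGenerator d}
    (fg-∃ λ i → fg-∃ λ j → fg-× (d ℕ.<? toℕ i ℕ.+ toℕ j) (fg-≡ (x i j)))

  antidiagonalIdeal-cut : ∀ d → FinitelyCut ⟨ (λ f → f ≡ antidiagonalProduct d) ⟩
  antidiagonalIdeal-cut d = ⟨⟩-cut (fg-≡ (antidiagonalProduct d))

  𝒥ᵈ-cut : ∀ d → FinitelyCut (𝒥ᵈ d)
  𝒥ᵈ-cut d = +ᴵ-cut (+ᴵ-cut 𝒥-cut (degreeIdeal-cut d)) (antidiagonalIdeal-cut d)

  𝒥-field : ∀ v → 𝒥 (var v ^ᴾ q -ᴾ var v)
  𝒥-field v = +ᴵ-right (⟨⟩-ideal LatinGenerator) {var v ^ᴾ q -ᴾ var v}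
    (generator FieldGenerator {var v ^ᴾ q -ᴾ var v}
      (let i , j = Fin.remQuot (ℕ.suc r) v in i , j ,
        ≡.cong (λ v → var v ^ᴾ q -ᴾ var v) (≡.sym (Fin.combine-remQuot {ℕ.suc r} (ℕ.suc r) v))))

  𝒥+symmetry-cut : FinitelyCut (𝒥 +ᴵ symmetryIdeal)
  𝒥+symmetry-cut = +ᴵ-cut 𝒥-cut symmetryIdeal-cut

  𝒥ᵈ+symmetry-cut : ∀ d → FinitelyCut (𝒥ᵈ d +ᴵ symmetryIdeal)
  𝒥ᵈ+symmetry-cut d = +ᴵ-cut (𝒥ᵈ-cut d) symmetryIdeal-cut

  𝒥⊆𝒥ᵈ : ∀ d {f} → 𝒥 f → 𝒥ᵈ d f
  𝒥⊆𝒥ᵈ d {f} f∈𝒥 = +ᴵ-left (FinitelyCut.isIdeal (antidiagonalIdeal-cut d)) {f}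
    (+ᴵ-left (⟨⟩-ideal (DegreeGenerator d)) {f} f∈𝒥)

  𝒥+symmetry-field : ∀ v → (𝒥 +ᴵ symmetryIdeal) (var v ^ᴾ q -ᴾ var v)
  𝒥+symmetry-field v = +ᴵ-left (⟨⟩-ideal SymmetryGenerator) {var v ^ᴾ q -ᴾ var v} (𝒥-field v)

  𝒥ᵈ+symmetry-field : ∀ d v → (𝒥ᵈ d +ᴵ symmetryIdeal) (var v ^ᴾ q -ᴾ var v)
  𝒥ᵈ+symmetry-field d v = +ᴵ-left (⟨⟩-ideal SymmetryGenerator) {var v ^ᴾ q -ᴾ var v}
    (𝒥⊆𝒥ᵈ d {var v ^ᴾ q -ᴾ var v} (𝒥-field v))

  𝒥⇒latin : ∀ s → AlgebraicSet 𝒥 s → IsLatin s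
  𝒥⇒latin s s∈V = vanish⇒latin s λ f f∈S → s∈V f
    (+ᴵ-left (⟨⟩-ideal FieldGenerator) {f} (generator LatinGenerator (LatinGeneratorᶠ⊆ f∈S)))

  latin⇒𝒥 : ∀ s → IsLatin s → AlgebraicSet 𝒥 s
  latin⇒𝒥 s s-latin = algebraicSet-+ᴵ s
    (algebraicSet-⟨⟩ {S = LatinGenerator} s (latin⇒vanish s s-latin))
    (algebraicSet-⟨⟩ {S = FieldGenerator} s (field⇒vanish s))

  symmetryIdeal⇒symmetric : ∀ s → AlgebraicSet symmetryIdeal s → IsSymmetric s
  symmetryIdeal⇒symmetric s s∈V i j with Fin.<-cmp i j
  ... | tri< i<j _ _    = begin
    entry s i j    ≈⟨ eval-x i j s ⟨
    eval (x i j) s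
      ≈⟨ x∙y⁻¹≈ε⇒x≈y _ _ (trans (sym (eval-minus (x i j) (x j i) s))
           (s∈V (x i j -ᴾ x j i)
             (generator SymmetryGenerator {x i j -ᴾ x j i} (i , j , i<j , ≡.refl)))) ⟩
    eval (x j i) s ≈⟨ eval-x j i s ⟩
    entry s j i    ∎
  ... | tri≈ _ ≡.refl _ = refl
  ... | tri> _ _ j<i    = begin
    entry s i j    ≈⟨ eval-x i j s ⟨
    eval (x i j) s
      ≈⟨ x∙y⁻¹≈ε⇒x≈y _ _ (trans (sym (eval-minus (x j i) (x i j) s))
           (s∈V (x j i -ᴾ x i j)
             (generator SymmetryGenerator {x j i -ᴾ x i j} (j , i , j<i , ≡.refl)))) ⟨
    eval (x j i) s ≈⟨ eval-x j i s ⟩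
    entry s j i    ∎

  symmetric⇒symmetryIdeal : ∀ s → IsSymmetric s → AlgebraicSet symmetryIdeal s
  symmetric⇒symmetryIdeal s s-sym =
    algebraicSet-⟨⟩ {S = SymmetryGenerator} s (symmetric⇒vanish s s-sym)

  -- If d > 2(q-2), no pair of indices lies on the antidiagonal and no array qualifies;
  -- correspondingly, `antidiagonalProduct d` is then a product of ones and the ideal is the whole
  -- ring.
  HasDegree : ℕ → Vector Carrier N → Set ℓ
  HasDegree d s = (∀ i j → toℕ i ℕ.+ toℕ j ℕ.> d → entry s i j ≈ 0#)
                × (∃[ i ] ∃[ j ] toℕ i ℕ.+ toℕ j ≡ d × ¬ entry s i j ≈ 0#)

  antidiagonalFactor : ℕ → Index → Index → Poly N
  antidiagonalFactor d i j = if does (toℕ i ℕ.+ toℕ j ℕ.≟ d) then F (x i j) else 1ᴾ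

  antidiagonalFactor-≡ : ∀ d i j → toℕ i ℕ.+ toℕ j ≡ d →
                         antidiagonalFactor d i j ≡ F (x i j)
  antidiagonalFactor-≡ d i j i+j≡d = ≡.cong (if_then F (x i j) else 1ᴾ)
    (dec-true (toℕ i ℕ.+ toℕ j ℕ.≟ d) i+j≡d)

  antidiagonalFactor-≢ : ∀ d i j → ¬ toℕ i ℕ.+ toℕ j ≡ d → antidiagonalFactor d i j ≡ 1ᴾ
  antidiagonalFactor-≢ d i j i+j≢d = ≡.cong (if_then F (x i j) else 1ᴾ)
    (dec-false (toℕ i ℕ.+ toℕ j ℕ.≟ d) i+j≢d)

  antidiagonalFactor≈0⇒ : ∀ d i j s → eval (antidiagonalFactor d i j) s ≈ 0# →
                          Dec (toℕ i ℕ.+ toℕ j ≡ d) →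
                          toℕ i ℕ.+ toℕ j ≡ d × ¬ entry s i j ≈ 0#
  antidiagonalFactor≈0⇒ d i j s factor≈0 (yes i+j≡d) = i+j≡d , λ sᵢⱼ≈0 →
    F≈0⇒≉0 (x i j) s
      (trans (reflexive (≡.cong (λ f → eval f s) (≡.sym (antidiagonalFactor-≡ d i j i+j≡d))))
        factor≈0)
      (trans (eval-x i j s) sᵢⱼ≈0)
  antidiagonalFactor≈0⇒ d i j s factor≈0 (no i+j≢d) = contradiction
    (trans (sym (eval-con 1# s)) (trans
      (reflexive (≡.cong (λ f → eval f s) (≡.sym (antidiagonalFactor-≢ d i j i+j≢d))))
      factor≈0))
    1≉0

  -- K has no zero divisors, so some factor vanishes at `s`. It cannot be a padding factor 1, and a
  -- factor `F (x i j)` vanishes only where the entry is nonzero.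
  antidiagonalProduct≈0⇒ : ∀ d s → eval (antidiagonalProduct d) s ≈ 0# →
                           ∃[ i ] ∃[ j ] toℕ i ℕ.+ toℕ j ≡ d × ¬ entry s i j ≈ 0#
  antidiagonalProduct≈0⇒ d s ∏≈0 =
    let i , row≈0 = product≈0 (λ i → eval (∏ (antidiagonalFactor d i)) s)
          (trans (sym (eval-∏ (λ i → ∏ (antidiagonalFactor d i)) s)) ∏≈0)
        j , factor≈0 = product≈0 (λ j → eval (antidiagonalFactor d i j) s)
          (trans (sym (eval-∏ (antidiagonalFactor d i) s)) row≈0)
    in i , j , antidiagonalFactor≈0⇒ d i j s factor≈0 (toℕ i ℕ.+ toℕ j ℕ.≟ d)

  ⇒antidiagonalProduct≈0 : ∀ d s i j → toℕ i ℕ.+ toℕ j ≡ d → ¬ entry s i j ≈ 0# →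
                           eval (antidiagonalProduct d) s ≈ 0#
  ⇒antidiagonalProduct≈0 d s i j i+j≡d sᵢⱼ≉0 =
    trans (eval-∏ (λ i → ∏ (antidiagonalFactor d i)) s)
      (factor≈0 (λ i → eval (∏ (antidiagonalFactor d i)) s) i
        (trans (eval-∏ (antidiagonalFactor d i) s)
          (factor≈0 (λ j → eval (antidiagonalFactor d i j) s) j
            (trans (reflexive (≡.cong (λ f → eval f s) (antidiagonalFactor-≡ d i j i+j≡d)))
              (≉0⇒F≈0 (x i j) s (sᵢⱼ≉0 ∘ trans (sym (eval-x i j s))))))))

  𝒥ᵈ⇒degree : ∀ d s → AlgebraicSet (𝒥ᵈ d) s → HasDegree d s
  𝒥ᵈ⇒degree d s s∈V =
      (λ i j i+j>d → trans (sym (eval-x i j s)) (s∈V (x i j)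
        (+ᴵ-left (FinitelyCut.isIdeal (antidiagonalIdeal-cut d)) {x i j}
          (+ᴵ-right (FinitelyCut.isIdeal 𝒥-cut) {x i j}
            (generator (DegreeGenerator d) (i , j , i+j>d , ≡.refl))))))
    , antidiagonalProduct≈0⇒ d s (s∈V (antidiagonalProduct d)
        (+ᴵ-right (FinitelyCut.isIdeal (+ᴵ-cut 𝒥-cut (degreeIdeal-cut d)))
          {antidiagonalProduct d}
          (generator (_≡ antidiagonalProduct d) {antidiagonalProduct d} ≡.refl)))

  latin∧degree⇒𝒥ᵈ : ∀ d s → IsLatin s → HasDegree d s → AlgebraicSet (𝒥ᵈ d) s
  latin∧degree⇒𝒥ᵈ d s s-latin (above≈0 , i , j , i+j≡d , sᵢⱼ≉0) = algebraicSet-+ᴵ s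
    (algebraicSet-+ᴵ s (latin⇒𝒥 s s-latin)
      (algebraicSet-⟨⟩ {S = DegreeGenerator d} s
        λ { f (i , j , i+j>d , ≡.refl) → trans (eval-x i j s) (above≈0 i j i+j>d) }))
    (algebraicSet-⟨⟩ {S = _≡ antidiagonalProduct d} s
      λ { f ≡.refl → ⇒antidiagonalProduct≈0 d s i j i+j≡d sᵢⱼ≉0 })

-- The bijection between zeros and symmetric local permutation polynomials

module Identification {c ℓ r} (K : FiniteField c ℓ (ℕ.suc (ℕ.suc r))) where

  open FiniteField K hiding (zero)
  open LocalPermutation K
  open X using (AlgebraicSet)
  open PolynomialRing commutativeRing
  open Evaluation commutativeRing
  open FiniteFieldProperties K
  open LatinSquares K
  open Coefficients commutativeRing
  open Univariate commutativeRing using (poly)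
  open ExpProperties commutativeSemiring using (_^_)
  open SumProperties semiring using (sum; sum-cong-≋; ∑-comm; *-distribʳ-sum)
  open MonoidHomomorphism +-commutativeMonoid using (sum-single)
  open SetoidReasoning setoid

  coeffs : Poly 2 → Vector Carrier N
  coeffs f v = let i , j = Fin.remQuot (ℕ.suc r) v in coefficients (ℕ.suc r) f i j

  entry-coeffs : ∀ f i j → entry (coeffs f) i j ≡ coeff f (toℕ i ∷ toℕ j ∷ [])
  entry-coeffs f i j = ≡.cong (λ (i , j) → coefficients (ℕ.suc r) f i j)
    (Fin.remQuot-combine {ℕ.suc r} i j)

  coeff-toPoly : ∀ s i j → coeff (toPoly s) (toℕ i ∷ toℕ j ∷ []) ≈ entry s i j
  coeff-toPoly s = coeff-grid-in (ℕ.suc r) (entry s)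

  -- Injectivity holds for all arrays, since entries are recovered as coefficients. What depends on
  -- I and S is that the array of each `f` in S is a zero of I and that `f` has no terms outside
  -- this array.
  identified : ∀ {a b} {I : Pred (Poly N) a} {S : Pred (Poly 2) b} →
               (∀ s → AlgebraicSet I s → S (toPoly s)) →
               (∀ f → S f → AlgebraicSet I (coeffs f)) →
               (∀ f → S f → f ≋ toPoly (coeffs f)) →
               IdentifiedByCoefficients I S
  identified toS fromS f≋ =
      toS
    , (λ {(s , _)} {(t , _)} → toPoly-injective s t)
    -- Surjectivity between setoids demands the equation for every array pointwise equal to the
    -- chosen preimage, hence `grid-cong`.
    , λ (f , f∈S) → (coeffs f , fromS f f∈S) , λ {(s , _)} s≈ → coeff-≈ (≋-trans
        (grid-cong (ℕ.suc r) {entry s} {entry (coeffs f)} (λ i j → s≈ (Fin.combine i j)))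
        (≋-sym (f≋ f f∈S)))
    where
    toPoly-injective : ∀ s t → toPoly s ≈ᴾ toPoly t → ∀ v → s v ≈ t v
    toPoly-injective s t eq v with i , j , ≡.refl ← Fin.combine-surjective {ℕ.suc r} {ℕ.suc r} v =
      trans (sym (coeff-toPoly s i j)) (trans (eq (toℕ i ∷ toℕ j ∷ [])) (coeff-toPoly t i j))

  -- The pigeonhole principle, applied to the conjugate of φ under the bijection of K with `Fin q`.
  injective⇒permutation : ∀ (φ : Carrier → Carrier) → (∀ {x y} → x ≈ y → φ x ≈ φ y) →
                          Injective _≈_ _≈_ φ → IsPermutation φ
  injective⇒permutation φ φ-cong φ-inj = φ-inj , λ y →
    let i , eq = injective⇒surjective (λ i → idx (φ (el i)))
          (λ {i} {j} eq → el-injective (φ-inj (trans (sym (el-idx (φ (el i))))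
            (trans (reflexive (≡.cong el eq)) (el-idx (φ (el j))))))) (idx y)
    in el i , λ z≈ → trans (φ-cong z≈) (trans (sym (el-idx (φ (el i))))
         (trans (reflexive (≡.cong el eq)) (el-idx y)))

  coeff-swap : ∀ f k l → coeff (swap f) (k ∷ l ∷ []) ≈ coeff f (l ∷ k ∷ [])
  coeff-swap []                      k l = refl
  coeff-swap ((a , i ∷ j ∷ []) ∷ f) k l = +-cong
    -- Equality of exponent vectors computes to the conjunction of the tests on their entries, and
    -- swapping the variables exchanges the two conjuncts.
    (reflexive (≡.cong (if_then a else 0#) (swap-∧ (i ℕ.≡ᵇ l) (j ℕ.≡ᵇ k))))
    (coeff-swap f k l)
    where
    swap-∧ : ∀ b b′ → b′ ∧ (b ∧ true) ≡ b ∧ (b′ ∧ true)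
    swap-∧ false false = ≡.refl
    swap-∧ false true  = ≡.refl
    swap-∧ true  false = ≡.refl
    swap-∧ true  true  = ≡.refl

  coeff≉0⇒< : ∀ s k l → ¬ coeff (toPoly s) (k ∷ l ∷ []) ≈ 0# →
              k ℕ.< ℕ.suc r × l ℕ.< ℕ.suc r
  coeff≉0⇒< s k l ≉0 with k ℕ.<? ℕ.suc r | l ℕ.<? ℕ.suc r
  ... | yes k< | yes l< = k< , l<
  ... | no k≮  | _      = contradiction (coeff-grid-out (ℕ.suc r) (entry s) k l (k≮ ∘ proj₁)) ≉0
  ... | yes _  | no l≮  = contradiction (coeff-grid-out (ℕ.suc r) (entry s) k l (l≮ ∘ proj₂)) ≉0

  coeff-toPoly-< : ∀ s {k l} (k< : k ℕ.< ℕ.suc r) (l< : l ℕ.< ℕ.suc r) →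
                   coeff (toPoly s) (k ∷ l ∷ []) ≈ entry s (Fin.fromℕ< k<) (Fin.fromℕ< l<)
  coeff-toPoly-< s k< l< = trans
    (reflexive (≡.cong₂ (λ k l → coeff (toPoly s) (k ∷ l ∷ []))
      (≡.sym (Fin.toℕ-fromℕ< k<)) (≡.sym (Fin.toℕ-fromℕ< l<))))
    (coeff-toPoly s (Fin.fromℕ< k<) (Fin.fromℕ< l<))

  toPoly-swap : ∀ s → IsSymmetric s → toPoly s ≈ᴾ swap (toPoly s)
  toPoly-swap s s-sym (k ∷ l ∷ []) = trans (symmetric (k ℕ.<? ℕ.suc r) (l ℕ.<? ℕ.suc r))
    (sym (coeff-swap (toPoly s) k l))
    where
    symmetric : Dec (k ℕ.< ℕ.suc r) → Dec (l ℕ.< ℕ.suc r) →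
                coeff (toPoly s) (k ∷ l ∷ []) ≈ coeff (toPoly s) (l ∷ k ∷ [])
    symmetric (yes k<) (yes l<) = trans (coeff-toPoly-< s k< l<)
      (trans (s-sym (Fin.fromℕ< k<) (Fin.fromℕ< l<)) (sym (coeff-toPoly-< s l< k<)))
    symmetric (no k≮)  _        = trans
      (coeff-grid-out (ℕ.suc r) (entry s) k l (k≮ ∘ proj₁))
      (sym (coeff-grid-out (ℕ.suc r) (entry s) l k (k≮ ∘ proj₂)))
    symmetric (yes _)  (no l≮)  = trans
      (coeff-grid-out (ℕ.suc r) (entry s) k l (l≮ ∘ proj₂))
      (sym (coeff-grid-out (ℕ.suc r) (entry s) l k (l≮ ∘ proj₁)))

  toPoly-LP : ∀ s → IsLatin s → LP (toPoly s)
  toPoly-LP s s-latin = degree , λ a →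
      injective⇒permutation (λ x → at (toPoly s) x a) (λ x≈y → at-congʳ (toPoly s) x≈y refl)
        (λ {x} {y} eq → decidable-stable (x ≈? y) λ x≉y → proj₂ (s-latin x y a x≉y)
          (trans (sym (at-toPoly s x a)) (trans eq (at-toPoly s y a))))
    , injective⇒permutation (λ x → at (toPoly s) a x) (λ x≈y → at-congʳ (toPoly s) refl x≈y)
        (λ {x} {y} eq → decidable-stable (x ≈? y) λ x≉y → proj₁ (s-latin x y a x≉y)
          (trans (sym (at-toPoly s a x)) (trans eq (at-toPoly s a y))))
    where
    degree : (DegreeInEachVariable< q) (toPoly s)
    degree (k ∷ l ∷ []) ≉0 zero       = ℕ.m<n⇒m<1+n (proj₁ (coeff≉0⇒< s k l ≉0))
    degree (k ∷ l ∷ []) ≉0 (suc zero) = ℕ.m<n⇒m<1+n (proj₂ (coeff≉0⇒< s k l ≉0))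

  toPoly-SLP : ∀ s → IsLatin s → IsSymmetric s → SLP (toPoly s)
  toPoly-SLP s s-latin s-sym = toPoly-LP s s-latin , toPoly-swap s s-sym

  toPoly-degree : ∀ d s → HasDegree d s → HasTotalDegree d (toPoly s)
  toPoly-degree d s (above≈0 , i , j , i+j≡d , sᵢⱼ≉0) =
      bounded
    , toℕ i ∷ toℕ j ∷ []
    , ≡.trans (≡.cong (toℕ i ℕ.+_) (ℕ.+-identityʳ (toℕ j))) i+j≡d
    , sᵢⱼ≉0 ∘ trans (sym (coeff-toPoly s i j))
    where
    bounded : ∀ m → ¬ coeff (toPoly s) m ≈ 0# → Vec.sum m ℕ.≤ d
    bounded (k ∷ l ∷ []) ≉0 = ℕ.≮⇒≥ λ d< → ≉0 (trans (coeff-toPoly-< s k< l<)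
      (above≈0 (Fin.fromℕ< k<) (Fin.fromℕ< l<)
        (≡.subst (d ℕ.<_) (≡.cong₂ ℕ._+_ (≡.sym (Fin.toℕ-fromℕ< k<))
          (≡.trans (ℕ.+-identityʳ l) (≡.sym (Fin.toℕ-fromℕ< l<)))) d<)))
      where
      k< : k ℕ.< ℕ.suc r
      k< = proj₁ (coeff≉0⇒< s k l ≉0)
      l< : l ℕ.< ℕ.suc r
      l< = proj₂ (coeff≉0⇒< s k l ≉0)

  sum-factor : ∀ {m n} (M : Fin m → Fin n → Carrier) (D : Fin n → Carrier) →
               sum (λ k → sum (λ i → M k i * D i)) ≈ sum (λ i → sum (λ k → M k i) * D i)
  sum-factor M D = trans (∑-comm (λ k i → M k i * D i))
    (sum-cong-≋ (λ i → sym (*-distribʳ-sum (D i) (λ k → M k i))))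

  module _ (1≤r : 1 ℕ.≤ r) (f : Poly 2) (f∈LP : LP f) where

    private
      f-degree : (DegreeInEachVariable< q) f
      f-degree = proj₁ f∈LP

      top : Fin q
      top = Fin.fromℕ (ℕ.suc r)

      C : Fin q → Fin q → Carrier
      C = coefficients q f

    outside-q : ∀ k l → ¬ (k ℕ.< q × l ℕ.< q) → coeff f (k ∷ l ∷ []) ≈ 0#
    outside-q k l out = decidable-stable (coeff f (k ∷ l ∷ []) ≈? 0#) λ ≉0 →
      out (f-degree (k ∷ l ∷ []) ≉0 zero , f-degree (k ∷ l ∷ []) ≉0 (suc zero))

    at-expand : ∀ a b → at f a b ≈ sum (λ i → a ^ toℕ i * poly (C i) b)
    at-expand a b = trans
      (eval-cong (≋-grid q f outside-q) (Vec.lookup (a ∷ b ∷ [])))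
      (trans (eval-grid q C (Vec.lookup (a ∷ b ∷ []))) (bilinear-poly C a b))

    -- The values of a permutation sum to 0, while Σ_a f(a, b) picks out the
    -- coefficient of x^(q-1).
    top-row-vanishes : ∀ b → poly (C top) b ≈ 0#
    top-row-vanishes b = *-cancel-0 powerSum-q-1 (begin
      powerSum (ℕ.suc r) * poly (C top) b
        ≡⟨ ≡.cong (λ k → powerSum k * poly (C top) b) (Fin.toℕ-fromℕ (ℕ.suc r)) ⟨
      powerSum (toℕ top) * poly (C top) b
        ≈⟨ sum-single top (λ i → powerSum (toℕ i) * poly (C i) b) (λ i top≢i →
             trans (*-congʳ (powerSum-< (toℕ i) (below i top≢i))) (zeroˡ _)) ⟨
      sum (λ i → powerSum (toℕ i) * poly (C i) b)
        ≈⟨ sum-factor (λ k i → el k ^ toℕ i) (λ i → poly (C i) b) ⟨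
      sum (λ k → sum (λ i → el k ^ toℕ i * poly (C i) b))
        ≈⟨ sum-cong-≋ {q} {λ k → at f (el k) b} (λ k → at-expand (el k) b) ⟨
      sum (λ k → at f (el k) b)
        ≈⟨ reindex +-commutativeMonoid (λ x → x) (λ x≈y → x≈y) (λ x → at f x b)
             (proj₁ (proj₁ (proj₂ f∈LP b))) ⟩
      sum el
        ≈⟨ sum-cong-≋ {q} {λ k → el k ^ 1} (λ k → *-identityʳ (el k)) ⟨
      powerSum 1
        -- Here q must exceed 2: over the field with two elements Σ a = 1, and x + y is a local
        -- permutation polynomial of degree q - 1 in each variable.
        ≈⟨ powerSum-< 1 1≤r ⟩
      0# ∎)
      where
      below : ∀ i → ¬ top ≡ i → toℕ i ℕ.≤ r
      below i top≢i = ℕ.≤-pred (ℕ.≤∧≢⇒< (ℕ.≤-pred (Fin.toℕ<n i)) λ eq →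
        top≢i (Fin.toℕ-injective (≡.trans (Fin.toℕ-fromℕ (ℕ.suc r)) (≡.sym eq))))

    -- As b varies, `poly (C top) b` is a univariate polynomial of degree below q that is zero on
    -- all of K, so its coefficients vanish; the degree condition of `LP` handles l ≥ q.
    coeff-top : ∀ l → coeff f (ℕ.suc r ∷ l ∷ []) ≈ 0#
    coeff-top l = decidable-stable (coeff f (ℕ.suc r ∷ l ∷ []) ≈? 0#) λ ≉0 →
      let l<q = f-degree (ℕ.suc r ∷ l ∷ []) ≉0 (suc zero) in
      ≉0 (trans
        (reflexive (≡.cong₂ (λ k l → coeff f (k ∷ l ∷ []))
          (≡.sym (Fin.toℕ-fromℕ (ℕ.suc r))) (≡.sym (Fin.toℕ-fromℕ< l<q))))
        (poly-injective (C top) top-row-vanishes (Fin.fromℕ< l<q)))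

    module _ (f-sym : f ≈ᴾ swap f) where

      coeff-sym : ∀ k l → coeff f (k ∷ l ∷ []) ≈ coeff f (l ∷ k ∷ [])
      coeff-sym k l = trans (f-sym (k ∷ l ∷ [])) (coeff-swap f k l)

      outside : ∀ k l → ¬ (k ℕ.< ℕ.suc r × l ℕ.< ℕ.suc r) → coeff f (k ∷ l ∷ []) ≈ 0#
      outside k l out = decidable-stable (coeff f (k ∷ l ∷ []) ≈? 0#) λ ≉0 →
        out ( below (f-degree (k ∷ l ∷ []) ≉0 zero)
                (λ { ≡.refl → ≉0 (coeff-top l) })
            , below (f-degree (k ∷ l ∷ []) ≉0 (suc zero))
                (λ { ≡.refl → ≉0 (trans (coeff-sym k (ℕ.suc r)) (coeff-top k)) }))
        where
        below : ∀ {k} → k ℕ.< q → ¬ k ≡ ℕ.suc r → k ℕ.< ℕ.suc r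
        below k<q k≢ = ℕ.≤∧≢⇒< (ℕ.≤-pred k<q) k≢

      ≋-toPoly : f ≋ toPoly (coeffs f)
      ≋-toPoly = ≋-trans (≋-grid (ℕ.suc r) f outside)
        (grid-cong (ℕ.suc r) {coefficients (ℕ.suc r) f} {entry (coeffs f)}
          (λ i j → reflexive (≡.sym (entry-coeffs f i j))))

      coeffs-symmetric : IsSymmetric (coeffs f)
      coeffs-symmetric i j = trans (reflexive (entry-coeffs f i j))
        (trans (coeff-sym (toℕ i) (toℕ j)) (reflexive (≡.sym (entry-coeffs f j i))))

      at-coeffs : ∀ a b → at f a b ≈ square (coeffs f) a b
      at-coeffs a b = trans (eval-cong ≋-toPoly (Vec.lookup (a ∷ b ∷ [])))
        (at-toPoly (coeffs f) a b)

      coeffs-latin : IsLatin (coeffs f)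
      coeffs-latin a b c a≉b =
          (λ eq → a≉b (proj₁ (proj₂ (proj₂ f∈LP c))
            (trans (at-coeffs c a) (trans eq (sym (at-coeffs c b))))))
        , (λ eq → a≉b (proj₁ (proj₁ (proj₂ f∈LP c))
            (trans (at-coeffs a c) (trans eq (sym (at-coeffs b c))))))

      coeffs-degree : ∀ d → HasTotalDegree d f → HasDegree d (coeffs f)
      coeffs-degree d (bounded , (k ∷ l ∷ []) , k+l≡d , ≉0) = above≈0 ,
          Fin.fromℕ< k< , Fin.fromℕ< l<
        , ≡.trans (≡.cong₂ ℕ._+_ (Fin.toℕ-fromℕ< k<)
            (≡.trans (Fin.toℕ-fromℕ< l<) (≡.sym (ℕ.+-identityʳ l)))) k+l≡d
        , λ ≈0 → ≉0 (trans (coeff-≈ ≋-toPoly (k ∷ l ∷ []))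
            (trans (coeff-toPoly-< (coeffs f) k< l<) ≈0))
        where
        above≈0 : ∀ i j → toℕ i ℕ.+ toℕ j ℕ.> d → entry (coeffs f) i j ≈ 0#
        above≈0 i j i+j>d = trans (reflexive (entry-coeffs f i j))
          (decidable-stable (coeff f (toℕ i ∷ toℕ j ∷ []) ≈? 0#) λ ≉0 → ℕ.<⇒≱ i+j>d
            (≡.subst (ℕ._≤ d) (≡.cong (toℕ i ℕ.+_) (ℕ.+-identityʳ (toℕ j)))
              (bounded (toℕ i ∷ toℕ j ∷ []) ≉0)))
        in-range : k ℕ.< ℕ.suc r × l ℕ.< ℕ.suc r
        in-range = coeff≉0⇒< (coeffs f) k l
          (≉0 ∘ trans (coeff-≈ ≋-toPoly (k ∷ l ∷ [])))
        k< : k ℕ.< ℕ.suc r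
        k< = proj₁ in-range
        l< : l ℕ.< ℕ.suc r
        l< = proj₂ in-range

proposition3p3 : ∀ {c ℓ : Level} (q : ℕ) → IsPrimePower q → q > 3 →
  (K : FiniteField c ℓ q) →
  let open LocalPermutation K
      open X
  in
    ( ZeroDimensional (𝒥 +ᴵ symmetryIdeal)
    × Radical (𝒥 +ᴵ symmetryIdeal)
    × IdentifiedByCoefficients (𝒥 +ᴵ symmetryIdeal) SLP )
    ×
    ( ∀ (d : ℕ) →
        ZeroDimensional (𝒥ᵈ d +ᴵ symmetryIdeal)
      × Radical (𝒥ᵈ d +ᴵ symmetryIdeal)
      × IdentifiedByCoefficients (𝒥ᵈ d +ᴵ symmetryIdeal) (SLPᵈ d) )
-- The bound on q is matched until q has the form r + 2 with r positive: then `q ∸ 1` computes to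
-- `suc r`, the form in which the modules above are stated, and `1≤r` provides Σ a = 0.
proposition3p3 (ℕ.suc (ℕ.suc r@(ℕ.suc _))) _ (s≤s (s≤s (s≤s _))) K =
    ( zeroDimensional 𝒥+symmetry-cut 𝒥+symmetry-field
    , radical 𝒥+symmetry-cut 𝒥+symmetry-field
    , identified
        (λ s s∈V → toPoly-SLP s (latin s s∈V) (symmetric s s∈V))
        (λ f (f∈LP , f-sym) → algebraicSet-+ᴵ (coeffs f)
          (latin⇒𝒥 (coeffs f) (coeffs-latin 1≤r f f∈LP f-sym))
          (symmetric⇒symmetryIdeal (coeffs f) (coeffs-symmetric 1≤r f f∈LP f-sym)))
        (λ f (f∈LP , f-sym) → ≋-toPoly 1≤r f f∈LP f-sym) )
  , λ d →
    ( zeroDimensional (𝒥ᵈ+symmetry-cut d) (𝒥ᵈ+symmetry-field d)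
    , radical (𝒥ᵈ+symmetry-cut d) (𝒥ᵈ+symmetry-field d)
    , identified
        (λ s s∈V → toPoly-SLP s (latinᵈ d s s∈V) (symmetricᵈ d s s∈V)
                 , toPoly-degree d s (𝒥ᵈ⇒degree d s (𝒥ᵈ-part d s s∈V)))
        (λ f ((f∈LP , f-sym) , f-degree) → algebraicSet-+ᴵ (coeffs f)
          (latin∧degree⇒𝒥ᵈ d (coeffs f) (coeffs-latin 1≤r f f∈LP f-sym)
            (coeffs-degree 1≤r f f∈LP f-sym d f-degree))
          (symmetric⇒symmetryIdeal (coeffs f) (coeffs-symmetric 1≤r f f∈LP f-sym)))
        (λ f ((f∈LP , f-sym) , _) → ≋-toPoly 1≤r f f∈LP f-sym) )
  where
  open FiniteField K using (commutativeRing)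
  open LocalPermutation K
  open X
  open LatinSquares K
  open Identification K
  open PolynomialIdeals commutativeRing N
  open FinitelyCut K N
  1≤r : 1 ℕ.≤ r
  1≤r = s≤s z≤n
  𝒥ᵈ-part : ∀ d s → AlgebraicSet (𝒥ᵈ d +ᴵ symmetryIdeal) s → AlgebraicSet (𝒥ᵈ d) s
  𝒥ᵈ-part d s s∈V f f∈I = s∈V f (+ᴵ-left (FinitelyCut.isIdeal symmetryIdeal-cut) {f} f∈I)
  latin : ∀ s → AlgebraicSet (𝒥 +ᴵ symmetryIdeal) s → IsLatin s
  latin s s∈V = 𝒥⇒latin s λ f f∈𝒥 →
    s∈V f (+ᴵ-left (FinitelyCut.isIdeal symmetryIdeal-cut) {f} f∈𝒥)
  latinᵈ : ∀ d s → AlgebraicSet (𝒥ᵈ d +ᴵ symmetryIdeal) s → IsLatin s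
  latinᵈ d s s∈V = 𝒥⇒latin s λ f f∈𝒥 → 𝒥ᵈ-part d s s∈V f (𝒥⊆𝒥ᵈ d {f} f∈𝒥)
  symmetric : ∀ s → AlgebraicSet (𝒥 +ᴵ symmetryIdeal) s → IsSymmetric s
  symmetric s s∈V = symmetryIdeal⇒symmetric s λ f f∈S →
    s∈V f (+ᴵ-right (FinitelyCut.isIdeal 𝒥-cut) {f} f∈S)
  symmetricᵈ : ∀ d s → AlgebraicSet (𝒥ᵈ d +ᴵ symmetryIdeal) s → IsSymmetric s
  symmetricᵈ d s s∈V = symmetryIdeal⇒symmetric s λ f f∈S →
    s∈V f (+ᴵ-right (FinitelyCut.isIdeal (𝒥ᵈ-cut d)) {f} f∈S)
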